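{- As $n\to\infty$, $\tilde r(n)\ge 2^{(2-\sqrt2)n-O(1)}$; that is, there is an absolute constant $C$ such that $\tilde r(n)\ge 2^{(2-\sqrt2)n-C}$ for all sufficiently large integers $n$.
   Context: The $(m,n)$-online Ramsey game is played by two players, Builder and Painter, on an infinite set of initially isolated vertices. Each turn, Builder places an edge between two nonadjacent vertices and Painter immediately paints it red or blue. The online Ramsey number $\tilde r(m,n)$ is the smallest number of turns within which Builder can guarantee the existence of either a red $K_m$ or a blue $K_n$, whatever Painter does. The diagonal online Ramsey number is $\tilde r(n):=\tilde r(n,n)$. -}

module Defs where

open import Data.Bool.Base using (true; false)
open import Data.Fin.Base as Fin using (Fin; zero; suc; toℕ; fromℕ<; finToFun; funToFin)
import Data.Fin.Properties as Fin
open import Data.Integer.Base as ℤ using (+_; -[1+_])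
open import Data.List.Base using (List; []; _∷_; length; map; filter; upTo; cartesianProduct)
open import Data.List.Membership.Propositional using (_∈_)
open import Data.List.Membership.Propositional.Properties
  using (∈-map⁺; ∈-map⁻; ∈-filter⁻; ∈-upTo⁺; ∈-upTo⁻; ∈-cartesianProduct⁺)
open import Data.List.Properties using (length-upTo)
open import Data.List.Relation.Unary.All as All using (All; []; _∷_)
open import Data.List.Relation.Unary.AllPairs using (_∷_)
open import Data.List.Relation.Unary.Any using (here; there)
open import Data.List.Relation.Unary.Unique.Propositional using (Unique)
import Data.List.Relation.Unary.Unique.Propositional.Properties as Unique
open import Data.Nat.Base as ℕ using (ℕ; zero; suc; z≤n; s≤s; _≤_; _<_; _⊔_)
import Data.Nat.Properties as ℕ
open import Data.Product.Base using (Σ-syntax; ∃; ∃₂; _×_; _,_; proj₁; proj₂)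
open import Data.Product.Properties using (≡-dec)
open import Data.Rational.Unnormalised.Base as ℚᵘ using (ℚᵘ; 0ℚᵘ; ↥_; ↧ₙ_)
open import Data.Sum.Base as Sum using (_⊎_; inj₁; inj₂)
open import Function.Base using (_∘_; id)
open import Function.Definitions using (Injective)
open import Relation.Binary.Definitions using (DecidableEquality)
open import Relation.Binary.PropositionalEquality
  using (_≡_; _≢_; refl; sym; trans; cong; cong₂; subst; subst₂)
open import Relation.Nullary.Decidable
  using (Dec; yes; no; does; map′; ¬?; _×-dec_; _⊎-dec_; _→-dec_)
open import Relation.Nullary.Negation using (¬_; contradiction)
open import Relation.Unary.Properties using (∁?)
import Data.List.Membership.DecPropositional as DecMembership

data Colour : Set where
  red blue : Colour

Vertex : Set
Vertex = ℕ

-- The painted edges so far.  A triple (u , v , c) stands for the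
-- undirected edge {u , v} painted c.
Position : Set
Position = List (Vertex × Vertex × Colour)

Edge : Colour → Position → Vertex → Vertex → Set
Edge c G u v = (u , v , c) ∈ G ⊎ (v , u , c) ∈ G

Adjacent : Position → Vertex → Vertex → Set
Adjacent G u v = ∃ λ c → Edge c G u v

record Clique (c : Colour) (m : ℕ) (G : Position) : Set where
  constructor clique
  field
    vertex    : Fin m → Vertex
    injective : Injective _≡_ _≡_ vertex
    complete  : ∀ i j → i ≢ j → Edge c G (vertex i) (vertex j)

Goal : ℕ → ℕ → Position → Set
Goal m n G = Clique red m G ⊎ Clique blue n G

-- Forces m n k G: starting from G, Builder can guarantee a red K_m or
-- a blue K_n within k further turns.
data Forces (m n : ℕ) : ℕ → Position → Set where
  done : ∀ {k G} → Goal m n G → Forces m n k G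
  turn : ∀ {k G} (u v : Vertex) → u ≢ v → ¬ Adjacent G u v →
         (∀ c → Forces m n k ((u , v , c) ∷ G)) →
         Forces m n (suc k) G

IsOnlineRamseyNumber : ℕ → ℕ → ℕ → Set
IsOnlineRamseyNumber m n r =
  Forces m n r [] × (∀ k → Forces m n k [] → r ≤ k)

-- onlineRamsey is an honest function only if a least r exists.  First,
-- Forces is decidable: only finitely many of Builder's moves matter,
-- because fresh vertices are interchangeable.

private

  _≟ᶜ_ : DecidableEquality Colour
  red  ≟ᶜ red  = yes refl
  red  ≟ᶜ blue = no λ ()
  blue ≟ᶜ red  = no λ ()
  blue ≟ᶜ blue = yes refl

  open DecMembership (≡-dec ℕ._≟_ (≡-dec ℕ._≟_ _≟ᶜ_)) using (_∈?_)

  edge? : ∀ c G u v → Dec (Edge c G u v)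
  edge? c G u v = ((u , v , c) ∈? G) ⊎-dec ((v , u , c) ∈? G)

  adjacent? : ∀ G u v → Dec (Adjacent G u v)
  adjacent? G u v = map′ from to (edge? red G u v ⊎-dec edge? blue G u v)
    where
    from : Edge red G u v ⊎ Edge blue G u v → Adjacent G u v
    from (inj₁ e) = red , e
    from (inj₂ e) = blue , e
    to : Adjacent G u v → Edge red G u v ⊎ Edge blue G u v
    to (red  , e) = inj₁ e
    to (blue , e) = inj₂ e

  edge-sym : ∀ {c G u v} → Edge c G u v → Edge c G v u
  edge-sym = Sum.swap

  bound : Position → ℕ
  bound []                = 0
  bound ((u , v , _) ∷ G) = suc u ⊔ suc v ⊔ bound G

  ∈-bound : ∀ {u v c} G → (u , v , c) ∈ G → u < bound G × v < bound G
  ∈-bound ((u , v , _) ∷ G) (here refl) =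
    ℕ.≤-trans (ℕ.m≤m⊔n (suc u) (suc v)) (ℕ.m≤m⊔n _ (bound G)) ,
    ℕ.≤-trans (ℕ.m≤n⊔m (suc u) (suc v)) (ℕ.m≤m⊔n _ (bound G))
  ∈-bound ((u , v , _) ∷ G) (there p) =
    ℕ.≤-trans (proj₁ (∈-bound G p)) (ℕ.m≤n⊔m _ (bound G)) ,
    ℕ.≤-trans (proj₂ (∈-bound G p)) (ℕ.m≤n⊔m _ (bound G))

  edge-bound : ∀ {c u v} G → Edge c G u v → u < bound G
  edge-bound G (inj₁ p) = proj₁ (∈-bound G p)
  edge-bound G (inj₂ p) = proj₂ (∈-bound G p)

  clique? : ∀ c m G → Dec (Clique c m G)
  clique? c 0 G = yes (clique (λ ()) (λ { {()} }) (λ ()))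
  clique? c 1 G = yes (clique (λ _ → 0) (λ { {zero} {zero} _ → refl })
                    (λ { zero zero i≢j → contradiction refl i≢j }))
  clique? c m@(suc (suc _)) G = map′ from to (Fin.any? good?)
    where
    at : Fin (bound G ℕ.^ m) → Fin m → Vertex
    at x i = toℕ (finToFun x i)

    Good : Fin (bound G ℕ.^ m) → Set
    Good x = ∀ i j → (at x i ≡ at x j → i ≡ j) ×
                     (i ≢ j → Edge c G (at x i) (at x j))

    good? : ∀ x → Dec (Good x)
    good? x = Fin.all? λ i → Fin.all? λ j →
      ((at x i ℕ.≟ at x j) →-dec (i Fin.≟ j)) ×-dec
      (¬? (i Fin.≟ j) →-dec edge? c G (at x i) (at x j))

    from : ∃ Good → Clique c m G
    from (x , g) = clique (at x) (λ {i} {j} → proj₁ (g i j)) (λ i j → proj₂ (g i j))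

    to : Clique c m G → ∃ Good
    to (clique f inj com) = x , λ i j →
        (λ eq → inj (trans (sym (at≡f i)) (trans eq (at≡f j)))) ,
        (λ i≢j → subst₂ (Edge c G) (sym (at≡f i)) (sym (at≡f j)) (com i j i≢j))
      where
      f<bound : ∀ i → f i < bound G
      f<bound zero    = edge-bound G (com zero (suc zero) λ ())
      f<bound (suc i) = edge-bound G (com (suc i) zero λ ())

      x : Fin (bound G ℕ.^ m)
      x = funToFin (λ i → fromℕ< (f<bound i))

      at≡f : ∀ i → at x i ≡ f i
      at≡f i = trans (cong toℕ (Fin.finToFun-funToFin (λ j → fromℕ< (f<bound j)) i))
                     (Fin.toℕ-fromℕ< (f<bound i))

  goal? : ∀ m n G → Dec (Goal m n G)
  goal? m n G = clique? red m G ⊎-dec clique? blue n G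

  relabel : (Vertex → Vertex) → Position → Position
  relabel π = map (λ (u , v , c) → π u , π v , c)

  edge-relabel⁺ : ∀ π {c G u v} → Edge c G u v → Edge c (relabel π G) (π u) (π v)
  edge-relabel⁺ π = Sum.map (∈-map⁺ _) (∈-map⁺ _)

  ∈-relabel⁻ : ∀ {π} → Injective _≡_ _≡_ π → ∀ {G u v c} →
               (π u , π v , c) ∈ relabel π G → (u , v , c) ∈ G
  ∈-relabel⁻ {π} inj {G} {u} {v} {c} p with ∈-map⁻ _ p
  ... | (u′ , v′ , c′) , q , eq
    with refl ← inj {u} {u′} (cong proj₁ eq)
       | refl ← inj {v} {v′} (cong (proj₁ ∘ proj₂) eq)
       | refl ← cong (proj₂ ∘ proj₂) eq = q

  goal-relabel : ∀ {π} → Injective _≡_ _≡_ π → ∀ {m n G} →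
                 Goal m n G → Goal m n (relabel π G)
  goal-relabel {π} inj {G = G} = Sum.map go go
    where
    go : ∀ {c m} → Clique c m G → Clique c m (relabel π G)
    go (clique f f-inj com) =
      clique (π ∘ f) (f-inj ∘ inj) (λ i j i≢j → edge-relabel⁺ π (com i j i≢j))

  forces-relabel : ∀ {π} → Injective _≡_ _≡_ π → ∀ {m n k G} →
                   Forces m n k G → Forces m n k (relabel π G)
  forces-relabel inj (done g) = done (goal-relabel inj g)
  forces-relabel {π} inj (turn u v u≢v ¬adj next) =
    turn (π u) (π v) (u≢v ∘ inj)
      (λ (c , e) → ¬adj (c , Sum.map (∈-relabel⁻ inj) (∈-relabel⁻ inj) e))
      (λ c → forces-relabel inj (next c))

  relabel-fixed : ∀ π G → (∀ x → x < bound G → π x ≡ x) → relabel π G ≡ G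
  relabel-fixed π G fix = go G (∈-bound G)
    where
    go : ∀ H → (∀ {u v c} → (u , v , c) ∈ H → u < bound G × v < bound G) →
         relabel π H ≡ H
    go []                _  = refl
    go ((u , v , c) ∷ H) lt = cong₂ _∷_
      (cong₂ (λ x y → x , y , c) (fix u (proj₁ (lt (here refl))))
                                 (fix v (proj₂ (lt (here refl)))))
      (go H (lt ∘ there))

  swap : ℕ → ℕ → ℕ → ℕ
  swap a b x with x ℕ.≟ a | x ℕ.≟ b
  ... | yes _ | _     = b
  ... | no _  | yes _ = a
  ... | no _  | no _  = x

  swap-left : ∀ a b → swap a b a ≡ b
  swap-left a b with a ℕ.≟ a | a ℕ.≟ b
  ... | yes _  | _ = refl
  ... | no a≢a | _ = contradiction refl a≢a

  swap-right : ∀ a b → swap a b b ≡ a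
  swap-right a b with b ℕ.≟ a | b ℕ.≟ b
  ... | yes b≡a | _      = b≡a
  ... | no _    | yes _  = refl
  ... | no _    | no b≢b = contradiction refl b≢b

  swap-other : ∀ a b x → x ≢ a → x ≢ b → swap a b x ≡ x
  swap-other a b x x≢a x≢b with x ℕ.≟ a | x ℕ.≟ b
  ... | yes x≡a | _       = contradiction x≡a x≢a
  ... | no _    | yes x≡b = contradiction x≡b x≢b
  ... | no _    | no _    = refl

  swap-involutive : ∀ a b x → swap a b (swap a b x) ≡ x
  swap-involutive a b x = by (x ℕ.≟ a) (x ℕ.≟ b)
    where
    by : Dec (x ≡ a) → Dec (x ≡ b) → swap a b (swap a b x) ≡ x
    by (yes refl) _          = trans (cong (swap a b) (swap-left a b)) (swap-right a b)
    by (no _)     (yes refl) = trans (cong (swap a b) (swap-right a b)) (swap-left a b)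
    by (no x≢a)   (no x≢b)   = trans (cong (swap a b) (swap-other a b x x≢a x≢b))
                                     (swap-other a b x x≢a x≢b)

  lower : ∀ N x → Σ[ π ∈ (ℕ → ℕ) ]
          Injective _≡_ _≡_ π × (∀ y → y < N → π y ≡ y) × π x < suc N
  lower N x with x ℕ.<? N
  ... | yes x<N = id , id , (λ _ _ → refl) , ℕ.m≤n⇒m≤1+n x<N
  ... | no  x≮N = swap x N
    , (λ {y} {z} eq → trans (sym (swap-involutive x N y))
                        (trans (cong (swap x N) eq) (swap-involutive x N z)))
    , (λ y y<N → swap-other x N y (λ { refl → x≮N y<N }) (ℕ.<⇒≢ y<N))
    , s≤s (ℕ.≤-reflexive (swap-left x N))

  forces? : ∀ m n k G → Dec (Forces m n k G)
  forces? m n zero    G = map′ done (λ { (done g) → g }) (goal? m n G)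
  forces? m n (suc k) G =
    map′ from to
      (goal? m n G ⊎-dec
       ℕ.anyUpTo? (λ u → ℕ.anyUpTo? (λ v → move? u v) (2 ℕ.+ bound G)) (2 ℕ.+ bound G))
    where
    Move : Vertex → Vertex → Set
    Move u v = u ≢ v × ¬ Adjacent G u v ×
      Forces m n k ((u , v , red) ∷ G) × Forces m n k ((u , v , blue) ∷ G)

    move? : ∀ u v → Dec (Move u v)
    move? u v = ¬? (u ℕ.≟ v) ×-dec ¬? (adjacent? G u v) ×-dec
      forces? m n k ((u , v , red) ∷ G) ×-dec forces? m n k ((u , v , blue) ∷ G)

    Moves : Set
    Moves = ∃ λ u → u < 2 ℕ.+ bound G × (∃ λ v → v < 2 ℕ.+ bound G × Move u v)

    from : Goal m n G ⊎ Moves → Forces m n (suc k) G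
    from (inj₁ g) = done g
    from (inj₂ (u , _ , v , _ , u≢v , ¬adj , r , b)) =
      turn u v u≢v ¬adj λ { red → r ; blue → b }

    to : Forces m n (suc k) G → Goal m n G ⊎ Moves
    to (done g) = inj₁ g
    to (turn u v u≢v ¬adj next)
      with π₁ , inj₁′ , fix₁ , u< ← lower (bound G) u
      with π₂ , inj₂′ , fix₂ , v< ← lower (suc (bound G)) (π₁ v) =
      inj₂ (π u , u<′ , π v , v< , u≢v ∘ inj , ¬adj′ , next′ red , next′ blue)
      where
      π : Vertex → Vertex
      π = π₂ ∘ π₁

      inj : Injective _≡_ _≡_ π
      inj = inj₁′ ∘ inj₂′

      u<′ : π u < 2 ℕ.+ bound G
      u<′ = subst (_< 2 ℕ.+ bound G) (sym (fix₂ (π₁ u) u<)) (ℕ.m≤n⇒m≤1+n u<)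

      fixed : relabel π G ≡ G
      fixed = relabel-fixed π G λ x x< →
        trans (cong π₂ (fix₁ x x<)) (fix₂ x (ℕ.m≤n⇒m≤1+n x<))

      ¬adj′ : ¬ Adjacent G (π u) (π v)
      ¬adj′ (c , e) = ¬adj (c , Sum.map (∈-relabel⁻ inj) (∈-relabel⁻ inj)
        (subst (λ H → Edge c H (π u) (π v)) (sym fixed) e))

      next′ : ∀ c → Forces m n k ((π u , π v , c) ∷ G)
      next′ c = subst (λ H → Forces m n k ((π u , π v , c) ∷ H)) fixed
                      (forces-relabel inj (next c))

  -- Second, Builder wins eventually, by building a large complete graph.

  record CliqueIn (c : Colour) (m : ℕ) (G : Position) (L : List Vertex) : Set where
    constructor cliqueIn
    field
      base   : Clique c m G
      inside : ∀ i → Clique.vertex base i ∈ L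

  emptyClique : ∀ {c G L} → CliqueIn c 0 G L
  emptyClique = cliqueIn (clique (λ ()) (λ { {()} }) (λ ())) (λ ())

  widen : ∀ {c m G L M} → (∀ {x} → x ∈ L → x ∈ M) → CliqueIn c m G L → CliqueIn c m G M
  widen L⊆M (cliqueIn K ins) = cliqueIn K (L⊆M ∘ ins)

  extend : ∀ {c m G x L M} → (∀ {y} → y ∈ L → x ≢ y × y ∈ M × Edge c G x y) →
           CliqueIn c m G L → CliqueIn c (suc m) G (x ∷ M)
  extend {c} {m} {G} {x} {L} {M} ok (cliqueIn (clique f inj com) ins) =
    cliqueIn (clique g g-inj g-com) g-ins
    where
    g : Fin (suc m) → Vertex
    g zero    = x
    g (suc i) = f i

    g-inj : Injective _≡_ _≡_ g
    g-inj {zero}  {zero}  _  = refl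
    g-inj {zero}  {suc j} eq = contradiction eq (proj₁ (ok (ins j)))
    g-inj {suc i} {zero}  eq = contradiction (sym eq) (proj₁ (ok (ins i)))
    g-inj {suc i} {suc j} eq = cong suc (inj eq)

    g-com : ∀ i j → i ≢ j → Edge c G (g i) (g j)
    g-com zero    zero    i≢j = contradiction refl i≢j
    g-com zero    (suc j) _   = proj₂ (proj₂ (ok (ins j)))
    g-com (suc i) zero    _   = edge-sym {c} {G} (proj₂ (proj₂ (ok (ins i))))
    g-com (suc i) (suc j) i≢j = com i j (i≢j ∘ cong suc)

    g-ins : ∀ i → g i ∈ x ∷ M
    g-ins zero    = here refl
    g-ins (suc i) = there (proj₁ (proj₂ (ok (ins i))))

  ramsey : ℕ → ℕ → ℕ
  ramsey zero    _       = 0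
  ramsey (suc _) zero    = 0
  ramsey (suc m) (suc n) = suc (ramsey m (suc n) ℕ.+ ramsey (suc m) n)

  length-filters : ∀ {P : Vertex → Set} (P? : ∀ x → Dec (P x)) xs →
    length xs ≡ length (filter P? xs) ℕ.+ length (filter (∁? P?) xs)
  length-filters P? []       = refl
  length-filters P? (x ∷ xs) with does (P? x)
  ... | true  = cong suc (length-filters P? xs)
  ... | false = trans (cong suc (length-filters P? xs)) (sym (ℕ.+-suc _ _))

  split-≤ : ∀ a b {c d} → a ℕ.+ b ≤ c ℕ.+ d → a ≤ c ⊎ b ≤ d
  split-≤ a b {c} {d} le with a ℕ.≤? c | b ℕ.≤? d
  ... | yes p | _     = inj₁ p
  ... | no _  | yes q = inj₂ q
  ... | no p  | no q  =
    contradiction le (ℕ.<⇒≱ (ℕ.+-mono-< (ℕ.≰⇒> p) (ℕ.≰⇒> q)))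

  ramsey-theorem : ∀ m n G L → Unique L →
    (∀ {u v} → u ∈ L → v ∈ L → u ≢ v → Adjacent G u v) →
    ramsey m n ≤ length L → CliqueIn red m G L ⊎ CliqueIn blue n G L
  ramsey-theorem zero    _       G L _ _ _ = inj₁ emptyClique
  ramsey-theorem (suc m) zero    G L _ _ _ = inj₂ emptyClique
  ramsey-theorem (suc m) (suc n) G (x ∷ L) (x∉L ∷ uniq) adj (s≤s le)
    with split-≤ (ramsey m (suc n)) (ramsey (suc m) n)
           (subst (ramsey m (suc n) ℕ.+ ramsey (suc m) n ≤_)
                  (length-filters (edge? red G x) L) le)
  ... | inj₁ le₁ = Sum.map (extend ok) (widen (there ∘ proj₁ ∘ ∈-filter⁻ R?))
        (ramsey-theorem m (suc n) G (filter R? L) (Unique.filter⁺ R? uniq) adj′ le₁)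
    where
    R? : ∀ y → Dec (Edge red G x y)
    R? = edge? red G x
    adj′ : ∀ {u v} → u ∈ filter R? L → v ∈ filter R? L → u ≢ v → Adjacent G u v
    adj′ p q = adj (there (proj₁ (∈-filter⁻ R? p))) (there (proj₁ (∈-filter⁻ R? q)))
    ok : ∀ {y} → y ∈ filter R? L → x ≢ y × y ∈ L × Edge red G x y
    ok p with y∈L , e ← ∈-filter⁻ R? p = All.lookup x∉L y∈L , y∈L , e
  ... | inj₂ le₂ = Sum.map (widen (there ∘ proj₁ ∘ ∈-filter⁻ B?)) (extend ok)
        (ramsey-theorem (suc m) n G (filter B? L) (Unique.filter⁺ B? uniq) adj′ le₂)
    where
    B? : ∀ y → Dec (¬ Edge red G x y)
    B? = ∁? (edge? red G x)
    adj′ : ∀ {u v} → u ∈ filter B? L → v ∈ filter B? L → u ≢ v → Adjacent G u v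
    adj′ p q = adj (there (proj₁ (∈-filter⁻ B? p))) (there (proj₁ (∈-filter⁻ B? q)))
    ok : ∀ {y} → y ∈ filter B? L → x ≢ y × y ∈ L × Edge blue G x y
    ok p with ∈-filter⁻ B? p
    ... | y∈L , ¬r with adj (here refl) (there y∈L) (All.lookup x∉L y∈L)
    ...   | red  , e = contradiction e ¬r
    ...   | blue , e = All.lookup x∉L y∈L , y∈L , e

  forces-suc : ∀ {m n k G} → Forces m n k G → Forces m n (suc k) G
  forces-suc (done g)                  = done g
  forces-suc (turn u v u≢v ¬adj next) = turn u v u≢v ¬adj (forces-suc ∘ next)

  Joined : Position → Vertex × Vertex → Set
  Joined G (u , v) = u ≢ v → Adjacent G u v

  adjacent-∷ : ∀ {e G u v} → Adjacent G u v → Adjacent (e ∷ G) u v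
  adjacent-∷ (c , p) = c , Sum.map there there p

  buildAll : ∀ {m n} ps G →
    (∀ H → (∀ {u v} → Adjacent G u v → Adjacent H u v) → All (Joined H) ps → Goal m n H) →
    Forces m n (length ps) G
  buildAll []             G goal = done (goal G id [])
  buildAll ((u , v) ∷ ps) G goal with u ℕ.≟ v | adjacent? G u v
  ... | yes u≡v | _       = forces-suc (buildAll ps G λ H G⊆H js →
        goal H G⊆H ((λ u≢v → contradiction u≡v u≢v) ∷ js))
  ... | no _    | yes adj = forces-suc (buildAll ps G λ H G⊆H js →
        goal H G⊆H ((λ _ → G⊆H adj) ∷ js))
  ... | no u≢v  | no ¬adj = turn u v u≢v ¬adj λ c →
        buildAll ps ((u , v , c) ∷ G) λ H G⊆H js →
          goal H (λ a → G⊆H (adjacent-∷ a)) ((λ _ → G⊆H (c , inj₁ (here refl))) ∷ js)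

  builderWins : ∀ m n → ∃ λ k → Forces m n k []
  builderWins m n = length ps , buildAll ps [] λ H _ js →
      Sum.map CliqueIn.base CliqueIn.base
        (ramsey-theorem m n H (upTo N) (Unique.upTo⁺ N)
          (λ p q → All.lookup js (∈-cartesianProduct⁺ p q))
          (ℕ.≤-reflexive (sym (length-upTo N))))
    where
    N  = ramsey m n
    ps = cartesianProduct (upTo N) (upTo N)

  least : ∀ {P : ℕ → Set} → (∀ k → Dec (P k)) → ∀ k → P k →
          ∃ λ r → P r × (∀ j → P j → r ≤ j)
  least P? zero    p = 0 , p , λ _ _ → z≤n
  least {P} P? (suc k) p with P? 0
  ... | yes p₀ = 0 , p₀ , λ _ _ → z≤n
  ... | no ¬p₀ with r , pr , min ← least (P? ∘ suc) k p = suc r , pr , min′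
    where
    min′ : ∀ j → P j → suc r ≤ j
    min′ zero    pj = contradiction pj ¬p₀
    min′ (suc j) pj = s≤s (min j pj)

abstract
  onlineRamseyNumber-exists : ∀ m n → ∃ (IsOnlineRamseyNumber m n)
  onlineRamseyNumber-exists m n with k , f ← builderWins m n =
    least (λ j → forces? m n j []) k f

onlineRamsey : ℕ → ℕ → ℕ
onlineRamsey m n = proj₁ (onlineRamseyNumber-exists m n)

onlineRamsey-spec : ∀ m n → IsOnlineRamseyNumber m n (onlineRamsey m n)
onlineRamsey-spec m n = proj₂ (onlineRamseyNumber-exists m n)

diagonalOnlineRamsey : ℕ → ℕ
diagonalOnlineRamsey n = onlineRamsey n n

-- Real numbers as Dedekind cuts of the rationals, given by the rationals
-- strictly below and those strictly above.  The cut laws are not bundled: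
-- they hold for rat and √2 and are preserved by the operations.

record Cut : Set₁ where
  field
    below above : ℚᵘ → Set

open Cut public

infixl 6 _⊖_
infixl 7 _·_

rat : ℚᵘ → Cut
rat p .below q = q ℚᵘ.< p
rat p .above q = p ℚᵘ.< q

√2 : Cut
√2 .below q = q ℚᵘ.< 0ℚᵘ ⊎ q ℚᵘ.* q ℚᵘ.< + 2 ℚᵘ./ 1
√2 .above q = 0ℚᵘ ℚᵘ.< q × + 2 ℚᵘ./ 1 ℚᵘ.< q ℚᵘ.* q

_⊖_ : Cut → Cut → Cut
(x ⊖ y) .below q = ∃₂ λ a b → below x a × above y b × q ℚᵘ.≤ a ℚᵘ.- b
(x ⊖ y) .above q = ∃₂ λ a b → above x a × below y b × a ℚᵘ.- b ℚᵘ.≤ q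

-- The inequalities are strict so that 0 · x is the cut of 0.
_·_ : ℕ → Cut → Cut
(n · x) .below q = ∃ λ a → below x a × q ℚᵘ.< (+ n ℚᵘ./ 1) ℚᵘ.* a
(n · x) .above q = ∃ λ a → above x a × (+ n ℚᵘ./ 1) ℚᵘ.* a ℚᵘ.< q

-- N ≥2^ℚ q says 2^q ≤ N.  For q = p / d this is 2^p ≤ N^d, with 2^|p|
-- moved to the right-hand side when p is negative.
_≥2^ℚ_ : ℕ → ℚᵘ → Set
N ≥2^ℚ q with ↥ q
... | + p      = 2 ℕ.^ p ≤ N ℕ.^ ↧ₙ q
... | -[1+ p ] = 1 ≤ 2 ℕ.^ suc p ℕ.* N ℕ.^ ↧ₙ q

-- 2^x is the supremum of 2^q over the rationals q < x.
infix 4 _≥2^_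
_≥2^_ : ℕ → Cut → Set
N ≥2^ x = ∀ q → below x q → N ≥2^ℚ q

{-# OPTIONS --safe #-}
-- Painter colours at random, which is derandomised here by a fair martingale.
-- Suppose a monochromatic K_n with n = 2c + d appears within N turns. Choose c
-- disjoint pairs of its vertices so that the sum of 3^(time of the pair's
-- edge) cannot be decreased by exchanging two vertices. Describe each pair by
-- the turn on which its edge was placed, revealing both vertices at once, and
-- each of the d other vertices by the turn on which it was first touched and
-- an endpoint. There are at most (3N)^(c+d) descriptions. An edge of the
-- clique is a hit if both its ends are revealed when it is placed; for a fixed
-- description, each hit gets the right colour with probability 1/2. By
-- minimality, at least two of the four edges between two pairs are hits, and
-- every edge meeting an unpaired vertex is one, so only about c² edges are not
-- hits. Hence
-- 2^(n²/2 - c² - O(n)) ≤ N^(n-c), and c = (1 - 1/√2) n is the best choice.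
module Submission where

open import Defs
open import Data.Empty using (⊥)
open import Data.Fin.Base
  using (Fin; zero; suc; toℕ; fromℕ<; _↑ˡ_; _↑ʳ_; splitAt; combine; remQuot; finToFun; funToFin)
open import Data.Fin.Permutation.Components using (transpose; transpose-inverse)
import Data.Fin.Properties as Fin
import Data.Integer.Properties as ℤ
open import Data.List.Base using ([]; _∷_; length)
open import Data.List.Membership.Propositional using (_∈_)
open import Data.List.Relation.Unary.Any using (here; there)
open import Data.Nat.Base
  using (ℕ; zero; suc; _+_; _*_; _^_; _∸_; _⊔_; _≤_; _<_; z≤n; s≤s; NonZero; >-nonZero; ⌊_/2⌋; ⌈_/2⌉)
open import Data.Nat.Induction using (<-wellFounded)
open import Data.Nat.Properties
open import Data.Nat.Tactic.RingSolver using (solve-∀)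
open import Data.Product.Base using (Σ-syntax; ∃; _×_; _,_; proj₁; proj₂)
open import Data.Rational.Unnormalised.Base as ℚᵘ using (ℚᵘ; mkℚᵘ; 0ℚᵘ; _/_)
import Data.Rational.Unnormalised.Properties as ℚᵘ
open import Data.Sum.Base as Sum using (_⊎_; inj₁; inj₂)
open import Function.Base using (_∘_)
open import Function.Definitions using (Injective)
open import Induction.WellFounded using (Acc; acc)
open import Relation.Binary.PropositionalEquality
open import Relation.Nullary.Decidable using (Dec; yes; no; _×-dec_; _⊎-dec_)
open import Relation.Nullary.Negation using (¬_; contradiction)
open import Algebra.Properties.Semiring.Sum +-*-semiring
  using (sum; ∑-distrib-+; *-distribˡ-sum; *-distribʳ-sum; sum-cong-≗)

-- Finite sums

sum-mono : ∀ {n} {f g : Fin n → ℕ} → (∀ i → f i ≤ g i) → sum f ≤ sum g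
sum-mono {zero}  f≤g = z≤n
sum-mono {suc n} f≤g = +-mono-≤ (f≤g zero) (sum-mono (f≤g ∘ suc))

term≤sum : ∀ {n} (f : Fin n → ℕ) i → f i ≤ sum f
term≤sum f zero    = m≤m+n _ _
term≤sum f (suc i) = ≤-trans (term≤sum (f ∘ suc) i) (m≤n+m _ _)

sum-const : ∀ n x → sum {n} (λ _ → x) ≡ n * x
sum-const zero    x = refl
sum-const (suc n) x = cong (x +_) (sum-const n x)

sum-≥ : ∀ {n x} {f : Fin n → ℕ} → (∀ i → x ≤ f i) → n * x ≤ sum f
sum-≥ {n} {x} x≤f = subst (_≤ _) (sum-const n x) (sum-mono x≤f)

sum-≤ : ∀ {n x} {f : Fin n → ℕ} → (∀ i → f i ≤ x) → sum f ≤ n * x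
sum-≤ {n} {x} f≤x = subst (_ ≤_) (sum-const n x) (sum-mono f≤x)

sum-splitAt : ∀ m {n} (f : Fin (m + n) → ℕ) →
              sum f ≡ sum (λ i → f (i ↑ˡ n)) + sum (λ j → f (m ↑ʳ j))
sum-splitAt zero    f = refl
sum-splitAt (suc m) f = trans (cong (f zero +_) (sum-splitAt m (f ∘ suc)))
                              (sym (+-assoc (f zero) _ _))

-- Stated without subtraction. It compares the total cost of a pairing after and before an exchange
-- that alters one pair.
sum-exchange₁ : ∀ {n} (g h : Fin n → ℕ) i → (∀ k → k ≢ i → g k ≡ h k) →
                sum g + h i ≡ sum h + g i
sum-exchange₁ g h zero eq
  rewrite sum-cong-≗ (λ k → eq (suc k) λ ()) = lemma (g zero) (sum (h ∘ suc)) (h zero)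
  where
  lemma : ∀ a b c → a + b + c ≡ c + b + a
  lemma = solve-∀
sum-exchange₁ g h (suc i) eq
  rewrite eq zero (λ ())
        | +-assoc (h zero) (sum (g ∘ suc)) (h (suc i))
        | +-assoc (h zero) (sum (h ∘ suc)) (g (suc i))
  = cong (h zero +_) (sum-exchange₁ (g ∘ suc) (h ∘ suc) i λ k k≢i → eq (suc k) (k≢i ∘ Fin.suc-injective))

sum-exchange₂ : ∀ {n} (g h : Fin n → ℕ) {i j} → i ≢ j →
                (∀ k → k ≢ i → k ≢ j → g k ≡ h k) →
                sum g + (h i + h j) ≡ sum h + (g i + g j)
sum-exchange₂ {n} g h {i} {j} i≢j eq = begin
  sum g + (h i + h j)  ≡⟨ +-assoc (sum g) (h i) (h j) ⟨
  sum g + h i + h j    ≡⟨ cong (λ x → sum g + x + h j) (sym mid-i) ⟩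
  sum g + mid i + h j  ≡⟨ cong (_+ h j) (sum-exchange₁ g mid i g≗mid) ⟩
  sum mid + g i + h j  ≡⟨ swap (sum mid) (g i) (h j) ⟩
  sum mid + h j + g i  ≡⟨ cong (_+ g i) (sum-exchange₁ mid h j mid≗h) ⟩
  sum h + mid j + g i  ≡⟨ cong (λ x → sum h + x + g i) (sym (g≗mid j (i≢j ∘ sym))) ⟩
  sum h + g j + g i    ≡⟨ swap′ (sum h) (g j) (g i) ⟩
  sum h + (g i + g j)  ∎
  where
  open ≡-Reasoning
  -- `mid` differs from `g` at most at `i` and from `h` at most at `j`.
  mid : Fin n → ℕ
  mid k with k Fin.≟ i
  ... | yes _ = h i
  ... | no _  = g k
  mid-i : mid i ≡ h i
  mid-i with i Fin.≟ i
  ... | yes _  = refl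
  ... | no i≢i = contradiction refl i≢i
  g≗mid : ∀ k → k ≢ i → g k ≡ mid k
  g≗mid k k≢i with k Fin.≟ i
  ... | yes k≡i = contradiction k≡i k≢i
  ... | no _    = refl
  mid≗h : ∀ k → k ≢ j → mid k ≡ h k
  mid≗h k k≢j with k Fin.≟ i
  ... | yes refl = refl
  ... | no k≢i   = eq k k≢i k≢j
  swap : ∀ a b c → a + b + c ≡ a + c + b
  swap = solve-∀
  swap′ : ∀ a b c → a + b + c ≡ a + (c + b)
  swap′ = solve-∀

⟦_⟧ : ∀ {a} {P : Set a} → Dec P → ℕ
⟦ yes _ ⟧ = 1
⟦ no _ ⟧  = 0

⟦⟧-yes : ∀ {P : Set} (P? : Dec P) → P → 1 ≤ ⟦ P? ⟧
⟦⟧-yes (yes _) p = s≤s z≤n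
⟦⟧-yes (no ¬p) p = contradiction p ¬p

sum-unique : ∀ {n} {P : Fin n → Set} (P? : ∀ i → Dec (P i)) →
             (∀ i j → P i → P j → i ≡ j) → sum (λ i → ⟦ P? i ⟧) ≤ 1
sum-unique {zero}  P? uniq = z≤n
sum-unique {suc n} P? uniq with P? zero
... | no _  = sum-unique (P? ∘ suc) (λ i j p q → Fin.suc-injective (uniq _ _ p q))
... | yes p = s≤s (≤-trans (sum-≤ {x = 0} none) (≤-reflexive (*-zeroʳ n)))
  where
  none : ∀ i → ⟦ P? (suc i) ⟧ ≤ 0
  none i with P? (suc i)
  ... | yes q = contradiction (uniq _ _ p q) λ ()
  ... | no _  = z≤n

-- With M = `a ⊔ b`, if `x` and `y` were both below M then 3^x + 3^y ≤ 2 · 3^(M-1) < 3^M ≤ 3^a +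
-- 3^b. Base 2 would allow equality in the middle.
3^-sum-≤⇒⊔-≤ : ∀ a b x y → 3 ^ a + 3 ^ b ≤ 3 ^ x + 3 ^ y → a ⊔ b ≤ x ⊎ a ⊔ b ≤ y
3^-sum-≤⇒⊔-≤ a b x y le with a ⊔ b ≤? x | a ⊔ b ≤? y
... | yes p | _     = inj₁ p
... | no _  | yes q = inj₂ q
... | no p  | no q  = contradiction le (<⇒≱ (go (a ⊔ b) (≰⇒> p) (≰⇒> q) max≤))
  where
  max≤ : 3 ^ (a ⊔ b) ≤ 3 ^ a + 3 ^ b
  max≤ with ⊔-sel a b
  ... | inj₁ eq = subst (λ e → 3 ^ e ≤ 3 ^ a + 3 ^ b) (sym eq) (m≤m+n _ _)
  ... | inj₂ eq = subst (λ e → 3 ^ e ≤ 3 ^ a + 3 ^ b) (sym eq) (m≤n+m _ _)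
  go : ∀ M → x < M → y < M → 3 ^ M ≤ 3 ^ a + 3 ^ b → 3 ^ x + 3 ^ y < 3 ^ a + 3 ^ b
  go (suc M) (s≤s x≤M) (s≤s y≤M) = <-≤-trans (begin-strict
    3 ^ x + 3 ^ y            ≤⟨ +-mono-≤ (^-monoʳ-≤ 3 x≤M) (^-monoʳ-≤ 3 y≤M) ⟩
    3 ^ M + 3 ^ M            <⟨ m<m+n (3 ^ M + 3 ^ M) (m^n>0 3 M) ⟩
    3 ^ M + 3 ^ M + 3 ^ M    ≡⟨ triple (3 ^ M) ⟩
    3 ^ suc M                ∎)
    where
    open ≤-Reasoning
    triple : ∀ z → z + z + z ≡ 3 * z
    triple = solve-∀

-- Positions, tokens and hits

-- The turn on which the oldest edge is placed is turn 0.
data EdgeAt : Position → ℕ → Vertex → Vertex → Set where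
  here  : ∀ {G t u v c x y} → t ≡ length G → (u ≡ x × v ≡ y) ⊎ (u ≡ y × v ≡ x) →
          EdgeAt ((u , v , c) ∷ G) t x y
  there : ∀ {G t e x y} → EdgeAt G t x y → EdgeAt (e ∷ G) t x y

edgeAt-sym : ∀ {G t x y} → EdgeAt G t x y → EdgeAt G t y x
edgeAt-sym (here eq j) = here eq (Sum.swap j)
edgeAt-sym (there p)   = there (edgeAt-sym p)

edgeAt-< : ∀ {G t x y} → EdgeAt G t x y → t < length G
edgeAt-< (here refl _) = ≤-refl
edgeAt-< (there p)     = m≤n⇒m≤1+n (edgeAt-< p)

joins? : ∀ (u v x y : Vertex) → Dec ((u ≡ x × v ≡ y) ⊎ (u ≡ y × v ≡ x))
joins? u v x y = ((u ≟ x) ×-dec (v ≟ y)) ⊎-dec ((u ≟ y) ×-dec (v ≟ x))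

-- Junk value 0 when x and y are not adjacent.
edgeTime : Position → Vertex → Vertex → ℕ
edgeTime []                x y = 0
edgeTime ((u , v , _) ∷ G) x y with joins? u v x y
... | yes _ = length G
... | no _  = edgeTime G x y

edgeTime-spec : ∀ {c x y} G → Edge c G x y → EdgeAt G (edgeTime G x y) x y
edgeTime-spec [] (inj₁ ())
edgeTime-spec [] (inj₂ ())
edgeTime-spec {x = x} {y} ((u , v , _) ∷ G) e with joins? u v x y
... | yes j = here refl j
edgeTime-spec _ (inj₁ (here refl)) | no ¬j = contradiction (inj₁ (refl , refl)) ¬j
edgeTime-spec _ (inj₂ (here refl)) | no ¬j = contradiction (inj₂ (refl , refl)) ¬j
edgeTime-spec (_ ∷ G) (inj₁ (there e)) | no _ = there (edgeTime-spec G (inj₁ e))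
edgeTime-spec (_ ∷ G) (inj₂ (there e)) | no _ = there (edgeTime-spec G (inj₂ e))

-- A `Position` is an arbitrary list; this restricts it to what legal play can produce, without
-- loops or repeated edges.
data Legal : Position → Set where
  []  : Legal []
  _∷_ : ∀ {u v c G} → u ≢ v × ¬ Adjacent G u v → Legal G → Legal ((u , v , c) ∷ G)

legal-≢ : ∀ {u v c G} → Legal G → (u , v , c) ∈ G → u ≢ v
legal-≢ ((u≢v , _) ∷ _) (here refl) = u≢v
legal-≢ (_ ∷ L)         (there p)   = legal-≢ L p

legal-colour : ∀ {u v c c′ G} → Legal G → (u , v , c) ∈ G → Edge c′ G u v → c′ ≡ c
legal-colour _ (here refl) (inj₁ (here refl)) = refl
legal-colour ((u≢u , _) ∷ _) (here refl) (inj₂ (here refl)) = refl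
legal-colour ((_ , ¬adj) ∷ _) (here refl) (inj₁ (there e)) = contradiction (_ , inj₁ e) ¬adj
legal-colour ((_ , ¬adj) ∷ _) (here refl) (inj₂ (there e)) = contradiction (_ , inj₂ e) ¬adj
legal-colour ((_ , ¬adj) ∷ _) (there p) (inj₁ (here refl)) = contradiction (_ , inj₁ p) ¬adj
legal-colour ((_ , ¬adj) ∷ _) (there p) (inj₂ (here refl)) = contradiction (_ , inj₂ p) ¬adj
legal-colour (_ ∷ L) (there p) (inj₁ (there e)) = legal-colour L p (inj₁ e)
legal-colour (_ ∷ L) (there p) (inj₂ (there e)) = legal-colour L p (inj₂ e)

-- Averaging over the two colours stands in for a random choice by Painter.
forces⇒≤ : ∀ {m n N B} (Φ : Position → ℕ) →
  (∀ u v G → Φ ((u , v , red) ∷ G) + Φ ((u , v , blue) ∷ G) ≡ 2 * Φ G) →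
  (∀ {G} → Legal G → length G ≤ N → Goal m n G → B ≤ Φ G) →
  ∀ {k G} → Legal G → k + length G ≤ N → Forces m n k G → B ≤ Φ G
forces⇒≤ Φ fair final {k} L len (done g) = final L (≤-trans (m≤n+m _ k) len) g
forces⇒≤ {N = N} {B} Φ fair final {suc k} {G} L len (turn u v u≢v ¬adj next) =
  *-cancelˡ-≤ 2 (begin
    2 * B ≡⟨ cong (B +_) (+-identityʳ B) ⟩
    B + B ≤⟨ +-mono-≤ (bound red) (bound blue) ⟩
    Φ ((u , v , red) ∷ G) + Φ ((u , v , blue) ∷ G) ≡⟨ fair u v G ⟩
    2 * Φ G ∎)
  where
  open ≤-Reasoning
  bound : ∀ c → B ≤ Φ ((u , v , c) ∷ G)
  bound c = forces⇒≤ Φ fair final ((u≢v , ¬adj) ∷ L)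
              (subst (_≤ N) (sym (+-suc k (length G))) len) (next c)

Mode : Set
Mode = Fin 3

pattern source = zero
pattern target = suc zero
pattern both   = suc (suc zero)

-- The token (t , m) names the endpoints selected by m of the edge placed on
-- turn t; which vertices these are is known once that turn is reached.
Token : Set
Token = ℕ × Mode

Selects : Mode → Vertex → Vertex → Vertex → Set
Selects source u v x = u ≡ x
Selects target u v x = v ≡ x
Selects both   u v x = u ≡ x ⊎ v ≡ x

selects? : ∀ m u v x → Dec (Selects m u v x)
selects? source u v x = u ≟ x
selects? target u v x = v ≟ x
selects? both   u v x = (u ≟ x) ⊎-dec (v ≟ x)

Reveals : Token → Position → Vertex → Set
Reveals k       []                x = ⊥
Reveals (t , m) ((u , v , _) ∷ G) x =
  (t ≡ length G × Selects m u v x) ⊎ Reveals (t , m) G x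

reveals? : ∀ k G x → Dec (Reveals k G x)
reveals? k       []                x = no λ ()
reveals? (t , m) ((u , v , _) ∷ G) x =
  ((t ≟ length G) ×-dec selects? m u v x) ⊎-dec reveals? (t , m) G x

reveals-< : ∀ {t m x} G → Reveals (t , m) G x → t < length G
reveals-< (_ ∷ G) (inj₁ (refl , _)) = ≤-refl
reveals-< (_ ∷ G) (inj₂ r)          = m≤n⇒m≤1+n (reveals-< G r)

both-reveals : ∀ {G t x y} → EdgeAt G t x y → Reveals (t , both) G x
both-reveals (here eq (inj₁ (u≡x , _))) = inj₁ (eq , inj₁ u≡x)
both-reveals (here eq (inj₂ (_ , v≡x))) = inj₁ (eq , inj₂ v≡x)
both-reveals (there p)                  = inj₂ (both-reveals p)

-- Turns are numbered by the length of the list before them, so a token names only one edge.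
both-reveals-only : ∀ {G t x y z} → EdgeAt G t x y → Reveals (t , both) G z → x ≡ z ⊎ y ≡ z
both-reveals-only (here _ (inj₁ (refl , refl))) (inj₁ (_ , s)) = s
both-reveals-only (here _ (inj₂ (refl , refl))) (inj₁ (_ , s)) = Sum.swap s
both-reveals-only (here refl _) (inj₂ r)          = contradiction (reveals-< _ r) (<-irrefl refl)
both-reveals-only (there p)     (inj₁ (refl , _)) = contradiction (edgeAt-< p) (<-irrefl refl)
both-reveals-only (there p)     (inj₂ r)          = both-reveals-only p r

-- A token for an unpaired vertex: `only` keeps it from revealing a vertex outside the clique, and
-- by `first` no edge at `x` comes too early to be a hit on account of `x`.
record FirstTouch (G : Position) (x : Vertex) : Set where
  field
    token   : Token
    reveals : Reveals token G x
    only    : ∀ {z} → Reveals token G z → x ≡ z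
    first   : ∀ {t y} → EdgeAt G t x y → proj₁ token ≤ t

open FirstTouch

firstTouch : ∀ G x → FirstTouch G x ⊎ (∀ {t y} → ¬ EdgeAt G t x y)
firstTouch [] x = inj₂ λ ()
firstTouch ((u , v , c) ∷ G) x with firstTouch G x
-- The head is the newest edge, so a touch in the tail is earlier and takes precedence.
... | inj₁ F = inj₁ λ where
  .token   → token F
  .reveals → inj₂ (reveals F)
  .only    → λ { (inj₁ (eq , _)) → contradiction (reveals-< G (reveals F)) (<-irrefl eq)
               ; (inj₂ r) → only F r }
  .first   → λ { (here refl _) → <⇒≤ (reveals-< G (reveals F)) ; (there p) → first F p }
... | inj₂ untouched with u ≟ x | v ≟ x
...   | yes u≡x | _ = inj₁ λ where
  .token   → length G , source
  .reveals → inj₁ (refl , u≡x)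
  .only    → λ { (inj₁ (_ , u≡z)) → trans (sym u≡x) u≡z
               ; (inj₂ r) → contradiction (reveals-< G r) (<-irrefl refl) }
  .first   → λ { (here refl _) → ≤-refl ; (there p) → contradiction p untouched }
...   | no _ | yes v≡x = inj₁ λ where
  .token   → length G , target
  .reveals → inj₁ (refl , v≡x)
  .only    → λ { (inj₁ (_ , v≡z)) → trans (sym v≡x) v≡z
               ; (inj₂ r) → contradiction (reveals-< G r) (<-irrefl refl) }
  .first   → λ { (here refl _) → ≤-refl ; (there p) → contradiction p untouched }
...   | no u≢x | no v≢x = inj₂ λ where
  (here _ (inj₁ (u≡x , _))) → u≢x u≡x
  (here _ (inj₂ (_ , v≡x))) → v≢x v≡x
  (there p) → untouched p

Revealed : ∀ {r} → (Fin r → Token) → Position → Vertex → Set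
Revealed τ G x = ∃ λ i → Reveals (τ i) G x

-- The colour of the new edge plays no role in Revealed, so whether it is a
-- hit is known before Painter moves.
Hit : ∀ {r} → (Fin r → Token) → Position → Vertex → Vertex → Set
Hit τ G u v = Revealed τ ((u , v , red) ∷ G) u × Revealed τ ((u , v , red) ∷ G) v

hit? : ∀ {r} (τ : Fin r → Token) G u v → Dec (Hit τ G u v)
hit? τ G u v = revealed? u ×-dec revealed? v
  where
  revealed? : ∀ x → Dec (Revealed τ ((u , v , red) ∷ G) x)
  revealed? x = Fin.any? λ i → reveals? (τ i) ((u , v , red) ∷ G) x

hits : ∀ {r} → (Fin r → Token) → Position → ℕ
hits τ []                = 0
hits τ ((u , v , _) ∷ G) = ⟦ hit? τ G u v ⟧ + hits τ G

-- The betting martingale of a description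

factor : ∀ {P : Set} → Dec P → Colour → Colour → ℕ
factor (no _)  _    _    = 1
factor (yes _) red  red  = 2
factor (yes _) red  blue = 0
factor (yes _) blue red  = 0
factor (yes _) blue blue = 2

factor-fair : ∀ {P : Set} (P? : Dec P) c → factor P? c red + factor P? c blue ≡ 2
factor-fair (no _)  _    = refl
factor-fair (yes _) red  = refl
factor-fair (yes _) blue = refl

-- The capital of a gambler who starts with 1 and stakes all of it, at even odds, on colour `c` at
-- every hit.
weight : ∀ {r} → (Fin r → Token) → Colour → Position → ℕ
weight τ c []                 = 1
weight τ c ((u , v , c′) ∷ G) = factor (hit? τ G u v) c c′ * weight τ c G

weight-fair : ∀ {r} (τ : Fin r → Token) c u v G →
  weight τ c ((u , v , red) ∷ G) + weight τ c ((u , v , blue) ∷ G) ≡ 2 * weight τ c G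
weight-fair τ c u v G = trans
  (sym (*-distribʳ-+ (weight τ c G) (factor (hit? τ G u v) c red) (factor (hit? τ G u v) c blue)))
  (cong (_* weight τ c G) (factor-fair (hit? τ G u v) c))

weight-hits : ∀ {r} (τ : Fin r → Token) c G →
  (∀ {u v c′} → (u , v , c′) ∈ G → Revealed τ G u → Revealed τ G v → c ≡ c′) →
  weight τ c G ≡ 2 ^ hits τ G
weight-hits τ c []                 mono = refl
weight-hits τ c ((u , v , c′) ∷ G) mono
  -- What is revealed in `G` remains so after one more edge, so the hypothesis passes to the tail.
  with ih ← weight-hits τ c G (λ { p (i , r) (j , s) → mono (there p) (i , inj₂ r) (j , inj₂ s) })
  with hit? τ G u v
... | no _ = trans (+-identityʳ _) ih
... | yes (r , s) with refl ← mono (here refl) r s with c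
...   | red  = cong (2 *_) ih
...   | blue = cong (2 *_) ih

-- Counting hits by pairs of vertices

same : Vertex → Vertex → ℕ
same x y = ⟦ x ≟ y ⟧

-- Products of indicators for the two orientations, so that double sums over `x` and `y` factor.
pairHits : ∀ {r} → (Fin r → Token) → Position → Vertex → Vertex → ℕ
pairHits τ []                x y = 0
pairHits τ ((u , v , _) ∷ G) x y =
  ⟦ hit? τ G u v ⟧ * (same u x * same v y + same v x * same u y) + pairHits τ G x y

-- Both tokens carry a turn no later than that of the edge, so what they reveal in `G` is already
-- revealed when the edge is placed; `old` discards the later entries.
pairHits-≥1 : ∀ {r} (τ : Fin r → Token) {G t x y} i j → EdgeAt G t x y →
  Reveals (τ i) G x → Reveals (τ j) G y → proj₁ (τ i) ≤ t → proj₁ (τ j) ≤ t →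
  1 ≤ pairHits τ G x y
pairHits-≥1 τ {(u , v , _) ∷ G} {x = x} {y} i j (here refl e) r s _ _ =
  ≤-trans (*-mono-≤ (⟦⟧-yes (hit? τ G u v) (hit e)) (joined e)) (m≤m+n _ _)
  where
  hit : (u ≡ x × v ≡ y) ⊎ (u ≡ y × v ≡ x) → Hit τ G u v
  hit (inj₁ (refl , refl)) = (i , r) , (j , s)
  hit (inj₂ (refl , refl)) = (j , s) , (i , r)
  joined : (u ≡ x × v ≡ y) ⊎ (u ≡ y × v ≡ x) → 1 ≤ same u x * same v y + same v x * same u y
  joined (inj₁ (p , q)) = ≤-trans (*-mono-≤ (⟦⟧-yes (u ≟ x) p) (⟦⟧-yes (v ≟ y) q)) (m≤m+n _ _)
  joined (inj₂ (p , q)) = ≤-trans (*-mono-≤ (⟦⟧-yes (v ≟ x) q) (⟦⟧-yes (u ≟ y) p)) (m≤n+m _ _)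
pairHits-≥1 τ {(u , v , _) ∷ G} {t} i j (there e) r s i≤t j≤t =
  ≤-trans (pairHits-≥1 τ i j e (old r i≤t) (old s j≤t) i≤t j≤t) (m≤n+m _ _)
  where
  old : ∀ {k z} → Reveals k ((u , v , red) ∷ G) z → proj₁ k ≤ t → Reveals k G z
  old (inj₁ (refl , _)) le = contradiction (edgeAt-< e) (≤⇒≯ le)
  old (inj₂ r)          _  = r

sum-same : ∀ {n} {f : Fin n → Vertex} → Injective _≡_ _≡_ f → ∀ u → sum (λ p → same u (f p)) ≤ 1
sum-same {f = f} inj u = sum-unique (λ p → u ≟ f p) λ p q eq eq′ → inj (trans (sym eq) eq′)

sum-product : ∀ {m n} (g : Fin m → ℕ) (h : Fin n → ℕ) →
              sum (λ p → sum (λ q → g p * h q)) ≡ sum g * sum h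
sum-product g h = trans (sum-cong-≗ λ p → sym (*-distribˡ-sum (g p) h))
                        (sym (*-distribʳ-sum (sum h) g))

sum-same² : ∀ {n} {f : Fin n → Vertex} → Injective _≡_ _≡_ f → ∀ u v →
            sum (λ p → sum (λ q → same u (f p) * same v (f q))) ≤ 1
sum-same² {f = f} inj u v = subst (_≤ 1) (sym (sum-product (same u ∘ f) (same v ∘ f)))
  (*-mono-≤ (sum-same inj u) (sum-same inj v))

∑∑-distrib-+ : ∀ {m n} (g h : Fin m → Fin n → ℕ) →
  sum (λ p → sum (λ q → g p q + h p q)) ≡ sum (λ p → sum (g p)) + sum (λ p → sum (h p))
∑∑-distrib-+ g h = trans (sum-cong-≗ λ p → ∑-distrib-+ (g p) (h p)) (∑-distrib-+ (sum ∘ g) (sum ∘ h))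

-- By injectivity a hit matches at most one ordered pair of indices in each orientation, hence the
-- factor 2.
sum-pairHits : ∀ {r n} (τ : Fin r → Token) G {f : Fin n → Vertex} → Injective _≡_ _≡_ f →
  sum (λ p → sum (λ q → pairHits τ G (f p) (f q))) ≤ 2 * hits τ G
sum-pairHits {n = n} τ [] inj = ≤-trans (sum-≤ {n} λ p → sum-≤ {n} {0} λ q → z≤n)
  (≤-reflexive (trans (cong (n *_) (*-zeroʳ n)) (*-zeroʳ n)))
sum-pairHits {n = n} τ ((u , v , _) ∷ G) {f} inj with hit? τ G u v
... | no _  = sum-pairHits τ G inj
... | yes _ = begin
  ∑∑ (λ p q → (A p q + B p q + 0) + C p q)  ≡⟨ ∑∑-cong (λ p q → cong (_+ C p q) (+-identityʳ _)) ⟩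
  ∑∑ (λ p q → (A p q + B p q) + C p q)  ≡⟨ ∑∑-distrib-+ (λ p q → A p q + B p q) C ⟩
  ∑∑ (λ p q → A p q + B p q) + ∑∑ C     ≡⟨ cong (_+ ∑∑ C) (∑∑-distrib-+ A B) ⟩
  ∑∑ A + ∑∑ B + ∑∑ C ≤⟨ +-mono-≤ (+-mono-≤ (sum-same² inj u v) (sum-same² inj v u)) (sum-pairHits τ G inj) ⟩
  2 + 2 * hits τ G                      ≡⟨ *-suc 2 (hits τ G) ⟨
  2 * suc (hits τ G)                    ∎
  where
  open ≤-Reasoning
  A B C : Fin n → Fin n → ℕ
  A p q = same u (f p) * same v (f q)
  B p q = same v (f p) * same u (f q)
  C p q = pairHits τ G (f p) (f q)
  ∑∑ : (Fin n → Fin n → ℕ) → ℕ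
  ∑∑ g = sum (λ p → sum (g p))
  ∑∑-cong : ∀ {g h} → (∀ p q → g p q ≡ h p q) → ∑∑ g ≡ ∑∑ h
  ∑∑-cong eq = sum-cong-≗ λ p → sum-cong-≗ (eq p)

-- Extremal arrangements of a clique

open Clique

transpose-matchˡ : ∀ {n} (i j : Fin n) → transpose i j i ≡ j
transpose-matchˡ i j with i Fin.≟ i
... | yes _  = refl
... | no i≢i = contradiction refl i≢i

transpose-matchʳ : ∀ {n} (i j : Fin n) → transpose i j j ≡ i
transpose-matchʳ i j with j Fin.≟ i
... | yes j≡i = j≡i
... | no _ with j Fin.≟ j
...   | yes _  = refl
...   | no j≢j = contradiction refl j≢j

transpose-mismatch : ∀ {n} {i j k : Fin n} → k ≢ i → k ≢ j → transpose i j k ≡ k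
transpose-mismatch {i = i} {j} {k} k≢i k≢j with k Fin.≟ i
... | yes k≡i = contradiction k≡i k≢i
... | no _ with k Fin.≟ j
...   | yes k≡j = contradiction k≡j k≢j
...   | no _    = refl

transpose-injective : ∀ {n} (i j : Fin n) → Injective _≡_ _≡_ (transpose i j)
transpose-injective i j {p} {q} eq =
  trans (sym (transpose-inverse j i)) (trans (cong (transpose j i) eq) (transpose-inverse j i))

↑ˡ≢↑ʳ : ∀ {m n} (i : Fin m) (j : Fin n) → i ↑ˡ n ≢ m ↑ʳ j
↑ˡ≢↑ʳ {m} {n} i j eq
  with () ← trans (sym (Fin.splitAt-↑ˡ m i n)) (trans (cong (splitAt m) eq) (Fin.splitAt-↑ʳ m n j))

-- The vertices of a clique of order c + (c + d) are arranged into c pairs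
-- and d single vertices.
module Arrangement (c d : ℕ) where

  n : ℕ
  n = c + (c + d)

  left right : Fin c → Fin n
  left i  = i ↑ˡ (c + d)
  right i = c ↑ʳ (i ↑ˡ d)

  single : Fin d → Fin n
  single s = c ↑ʳ (c ↑ʳ s)

  left-injective : ∀ {i j} → left i ≡ left j → i ≡ j
  left-injective = Fin.↑ˡ-injective (c + d) _ _

  right-injective : ∀ {i j} → right i ≡ right j → i ≡ j
  right-injective = Fin.↑ˡ-injective d _ _ ∘ Fin.↑ʳ-injective c _ _

  left≢right : ∀ i j → left i ≢ right j
  left≢right i j = ↑ˡ≢↑ʳ i (j ↑ˡ d)

  left≢single : ∀ i s → left i ≢ single s
  left≢single i s = ↑ˡ≢↑ʳ i (c ↑ʳ s)

  right≢single : ∀ i s → right i ≢ single s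
  right≢single i s = ↑ˡ≢↑ʳ i s ∘ Fin.↑ʳ-injective c _ _

  -- Since 2 · 3^(M-1) < 3^M, an exchange that leaves only edges placed before
  -- turn M in place of two pairs, one joined on turn M, lowers the total cost.
  cost : Position → (Fin n → Vertex) → Fin c → ℕ
  cost G f i = 3 ^ edgeTime G (f (left i)) (f (right i))

  Stable : Position → (Fin n → Vertex) → Set
  Stable G f = ∀ p q → sum (cost G f) ≤ sum (cost G (f ∘ transpose p q))

  -- Exchanges that lower the cost cannot go on for ever, since the cost is a natural number.
  stabilise : ∀ {κ G} (K : Clique κ n G) → Acc _<_ (sum (cost G (vertex K))) →
              ∃ λ (K′ : Clique κ n G) → Stable G (vertex K′)
  stabilise {G = G} K@(clique f inj com) (acc rs)
    with Fin.any? (λ p → Fin.any? λ q → sum (cost G (f ∘ transpose p q)) <? sum (cost G f))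
  ... | no stable = K , λ p q → ≮⇒≥ λ lt → stable (p , q , lt)
  ... | yes (p , q , lt) = stabilise
    (clique (f ∘ transpose p q) (transpose-injective p q ∘ inj)
            (λ i j i≢j → com _ _ (i≢j ∘ transpose-injective p q)))
    (rs lt)

  module _ {G f} (st : Stable G f) where

    private
      time : Fin n → Fin n → ℕ
      time p q = edgeTime G (f p) (f q)

      fixes : Fin n → Fin n → Fin c → Set
      fixes p q k = transpose p q (left k) ≡ left k × transpose p q (right k) ≡ right k

      swapped : Fin n → Fin n → Fin c → ℕ
      swapped p q = cost G (f ∘ transpose p q)

      swapped-fixes : ∀ {p q k} → fixes p q k → swapped p q k ≡ cost G f k
      swapped-fixes (eq , eq′) = cong₂ (λ x y → 3 ^ time x y) eq eq′

      -- The other pairs keep their cost, so the comparison of totals cancels down to the old and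
      -- the new edge of pair `i`.
      stable₁ : ∀ p q i {x y} → transpose p q (left i) ≡ x → transpose p q (right i) ≡ y →
        (∀ k → k ≢ i → fixes p q k) → time (left i) (right i) ≤ time x y
      stable₁ p q i refl refl fixed =
        ≮⇒≥ λ lt → <⇒≱ (^-monoʳ-< 3 (s≤s (s≤s z≤n)) lt) (+-cancelˡ-≤ (sum g) _ _ (begin
          sum g + cost G f i   ≡⟨ sum-exchange₁ g (cost G f) i (λ k k≢i → swapped-fixes (fixed k k≢i)) ⟩
          sum (cost G f) + g i ≤⟨ +-monoˡ-≤ (g i) (st p q) ⟩
          sum g + g i          ∎))
        where
        open ≤-Reasoning
        g : Fin c → ℕ
        g = swapped p q

      -- Two pairs change and only the sum of their costs is controlled; base 3 extracts from it one
      -- new edge at least as late as both old ones.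
      stable₂ : ∀ p q {i j} → i ≢ j → ∀ {x y z w} →
        transpose p q (left i) ≡ x → transpose p q (right i) ≡ y →
        transpose p q (left j) ≡ z → transpose p q (right j) ≡ w →
        (∀ k → k ≢ i → k ≢ j → fixes p q k) →
        time (left i) (right i) ⊔ time (left j) (right j) ≤ time x y ⊎
        time (left i) (right i) ⊔ time (left j) (right j) ≤ time z w
      stable₂ p q {i} {j} i≢j {x} {y} {z} {w} refl refl refl refl fixed =
        3^-sum-≤⇒⊔-≤ (time (left i) (right i)) (time (left j) (right j)) (time x y) (time z w)
          (+-cancelˡ-≤ (sum g) _ _ (begin
            sum g + (cost G f i + cost G f j)
              ≡⟨ sum-exchange₂ g (cost G f) i≢j (λ k k≢i k≢j → swapped-fixes (fixed k k≢i k≢j)) ⟩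
            sum (cost G f) + (g i + g j)
              ≤⟨ +-monoˡ-≤ (g i + g j) (st p q) ⟩
            sum g + (g i + g j) ∎))
        where
        open ≤-Reasoning
        g : Fin c → ℕ
        g = swapped p q

    -- Exchanging `right i` with `left j` pairs left with left and right with right. By the turn of
    -- the later new edge, all four vertices are revealed.
    stable-parallel : ∀ {i j} → i ≢ j →
      time (left i) (right i) ⊔ time (left j) (right j) ≤ time (left i) (left j) ⊎
      time (left i) (right i) ⊔ time (left j) (right j) ≤ time (right i) (right j)
    stable-parallel {i} {j} i≢j = stable₂ (right i) (left j) i≢j
      (transpose-mismatch (left≢right i i) (i≢j ∘ left-injective))
      (transpose-matchˡ (right i) (left j))
      (transpose-matchʳ (right i) (left j))
      (transpose-mismatch (i≢j ∘ sym ∘ right-injective) (left≢right j j ∘ sym))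
      λ k k≢i k≢j → transpose-mismatch (left≢right k i) (k≢j ∘ left-injective) ,
                    transpose-mismatch (k≢i ∘ right-injective) (left≢right j k ∘ sym)

    -- Exchanging `right i` with `right j` gives the other re-pairing, whose edges differ from the
    -- parallel ones. Together the two give two hits between any two pairs.
    stable-cross : ∀ {i j} → i ≢ j →
      time (left i) (right i) ⊔ time (left j) (right j) ≤ time (left i) (right j) ⊎
      time (left i) (right i) ⊔ time (left j) (right j) ≤ time (left j) (right i)
    stable-cross {i} {j} i≢j = stable₂ (right i) (right j) i≢j
      (transpose-mismatch (left≢right i i) (left≢right i j))
      (transpose-matchˡ (right i) (right j))
      (transpose-mismatch (left≢right j i) (left≢right j j))
      (transpose-matchʳ (right i) (right j))
      λ k k≢i k≢j → transpose-mismatch (left≢right k i) (left≢right k j) ,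
                    transpose-mismatch (k≢i ∘ right-injective) (k≢j ∘ right-injective)

    stable-left-single : ∀ i s → time (left i) (right i) ≤ time (left i) (single s)
    stable-left-single i s = stable₁ (right i) (single s) i
      (transpose-mismatch (left≢right i i) (left≢single i s))
      (transpose-matchˡ (right i) (single s))
      λ k k≢i → transpose-mismatch (left≢right k i) (left≢single k s) ,
                transpose-mismatch (k≢i ∘ right-injective) (right≢single k s)

    stable-single-right : ∀ i s → time (left i) (right i) ≤ time (single s) (right i)
    stable-single-right i s = stable₁ (left i) (single s) i
      (transpose-matchˡ (left i) (single s))
      (transpose-mismatch (left≢right i i ∘ sym) (right≢single i s))
      λ k k≢i → transpose-mismatch (k≢i ∘ left-injective) (left≢single k s) ,
                transpose-mismatch (left≢right i k ∘ sym) (right≢single k s)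

  sum-arrange : ∀ (h : Fin n → ℕ) →
    sum h ≡ sum (h ∘ left) + (sum (h ∘ right) + sum (h ∘ single))
  sum-arrange h = trans (sum-splitAt c h) (cong (sum (h ∘ left) +_) (sum-splitAt c (h ∘ (c ↑ʳ_))))

  -- Ordered pairs of vertices form c² blocks of pair against pair, worth at least 2 each, 4cd
  -- entries of a paired against a single vertex, and d² of two singles.
  ∑∑-arrange-≥ : ∀ (F : Fin n → Fin n → ℕ) →
    (∀ i j → 2 ≤ (F (left i) (left j) + F (right i) (right j)) +
                 (F (left i) (right j) + F (right i) (left j))) →
    (∀ i s → 1 ≤ F (left i) (single s)) → (∀ i s → 1 ≤ F (right i) (single s)) →
    (∀ s i → 1 ≤ F (single s) (left i)) → (∀ s i → 1 ≤ F (single s) (right i)) →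
    (∀ s t → 1 ≤ F (single s) (single t)) →
    2 * (c * c) + 4 * (c * d) + d * d ≤ sum (λ p → sum (F p))
  ∑∑-arrange-≥ F pp ls rs sl sr ss = begin
    2 * (c * c) + 4 * (c * d) + d * d
      ≡⟨ expand c d ⟩
    c * (c * 2 + (d * 1 + d * 1)) + d * (c * 1 + (c * 1 + d * 1))
      ≤⟨ +-mono-≤ (sum-≥ pairs) (sum-≥ singles) ⟩
    sum (λ i → sum (F (left i)) + sum (F (right i))) + sum (λ s → sum (F (single s)))
      ≡⟨ cong (_+ sum (λ s → sum (F (single s)))) (∑-distrib-+ (λ i → sum (F (left i))) (λ i → sum (F (right i)))) ⟩
    sum (λ i → sum (F (left i))) + sum (λ i → sum (F (right i))) + sum (λ s → sum (F (single s)))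
      ≡⟨ +-assoc (sum λ i → sum (F (left i))) _ _ ⟩
    sum (λ i → sum (F (left i))) + (sum (λ i → sum (F (right i))) + sum (λ s → sum (F (single s))))
      ≡⟨ sum-arrange (λ p → sum (F p)) ⟨
    sum (λ p → sum (F p)) ∎
    where
    open ≤-Reasoning
    expand : ∀ c d → 2 * (c * c) + 4 * (c * d) + d * d ≡
             c * (c * 2 + (d * 1 + d * 1)) + d * (c * 1 + (c * 1 + d * 1))
    expand = solve-∀
    regroup : ∀ a b e f g h → a + b + (e + f) + (g + h) ≡ a + (e + g) + (f + (b + h))
    regroup = solve-∀
    singles : ∀ s → c * 1 + (c * 1 + d * 1) ≤ sum (F (single s))
    singles s rewrite sum-arrange (F (single s)) =
      +-mono-≤ (sum-≥ (sl s)) (+-mono-≤ (sum-≥ (sr s)) (sum-≥ (ss s)))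
    pairs : ∀ i → c * 2 + (d * 1 + d * 1) ≤ sum (F (left i)) + sum (F (right i))
    pairs i = begin
      c * 2 + (d * 1 + d * 1)
        ≤⟨ +-mono-≤ (sum-≥ (pp i)) (+-mono-≤ (sum-≥ (ls i)) (sum-≥ (rs i))) ⟩
      sum (λ j → (ll j + rr j) + (lr j + rl j)) + (sum (F (left i) ∘ single) + sum (F (right i) ∘ single))
        ≡⟨ cong (_+ (sum (F (left i) ∘ single) + sum (F (right i) ∘ single))) (trans (∑-distrib-+ (λ j → ll j + rr j) (λ j → lr j + rl j))
             (cong₂ _+_ (∑-distrib-+ ll rr) (∑-distrib-+ lr rl))) ⟩
      sum ll + sum rr + (sum lr + sum rl) + (sum (F (left i) ∘ single) + sum (F (right i) ∘ single))
        ≡⟨ regroup (sum ll) (sum rr) (sum lr) (sum rl) _ _ ⟩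
      sum ll + (sum lr + sum (F (left i) ∘ single)) + (sum rl + (sum rr + sum (F (right i) ∘ single)))
        ≡⟨ cong₂ _+_ (sum-arrange (F (left i))) (sum-arrange (F (right i))) ⟨
      sum (F (left i)) + sum (F (right i)) ∎
      where
      ll lr rl rr : Fin c → ℕ
      ll j = F (left i) (left j)
      lr j = F (left i) (right j)
      rl j = F (right i) (left j)
      rr j = F (right i) (right j)

  -- The description of a stable clique

  module Encoding {κ G} (L : Legal G) (K : Clique κ n G) (st : Stable G (vertex K)) (i₀ : Fin c) where

    private
      f : Fin n → Vertex
      f = vertex K

      time : Fin n → Fin n → ℕ
      time p q = edgeTime G (f p) (f q)

      at : ∀ {p q} → p ≢ q → EdgeAt G (time p q) (f p) (f q)
      at p≢q = edgeTime-spec G (complete K _ _ p≢q)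

      touch : ∀ s → FirstTouch G (f (single s))
      touch s with firstTouch G (f (single s))
      ... | inj₁ F         = F
      -- The edge to `left i₀` touches the vertex, so the existence of a pair excludes this case.
      ... | inj₂ untouched = contradiction (edgeAt-sym (at (left≢single i₀ s))) untouched

    tokenOf : Fin c ⊎ Fin d → Token
    tokenOf (inj₁ i) = time (left i) (right i) , both
    tokenOf (inj₂ s) = token (touch s)

    tokens : Fin (c + d) → Token
    tokens k = tokenOf (splitAt c k)

    private
      revealedIn : ∀ {z} o → Reveals (tokenOf o) G z → ∃ λ p → f p ≡ z
      revealedIn (inj₁ i) r with both-reveals-only (at (left≢right i i)) r
      ... | inj₁ eq = left i , eq
      ... | inj₂ eq = right i , eq
      revealedIn (inj₂ s) r = single s , only (touch s) r

    tokens-< : ∀ k → proj₁ (tokens k) < length G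
    tokens-< k with splitAt c k
    ... | inj₁ i = edgeAt-< (at (left≢right i i))
    ... | inj₂ s = reveals-< G (reveals (touch s))

    module _ {τ : Fin (c + d) → Token} (τ≗ : ∀ k → τ k ≡ tokens k) where

      private
        pairToken : ∀ i → τ (i ↑ˡ d) ≡ tokenOf (inj₁ i)
        pairToken i = trans (τ≗ _) (cong tokenOf (Fin.splitAt-↑ˡ c i d))

        singleToken : ∀ s → τ (c ↑ʳ s) ≡ tokenOf (inj₂ s)
        singleToken s = trans (τ≗ _) (cong tokenOf (Fin.splitAt-↑ʳ c d s))

      -- Revealed vertices all lie in the clique, and by legality the edge between two of them has
      -- no second colour.
      monochromatic : ∀ {u v κ′} → (u , v , κ′) ∈ G → Revealed τ G u → Revealed τ G v → κ ≡ κ′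
      monochromatic e (k , r) (l , r′)
        with p , refl ← revealedIn (splitAt c k) (subst (λ t → Reveals t G _) (τ≗ k) r)
        with q , refl ← revealedIn (splitAt c l) (subst (λ t → Reveals t G _) (τ≗ l) r′)
        = legal-colour L e (complete K p q λ { refl → legal-≢ L e refl })

      private
        known-≥1 : ∀ {o o′ p q} k l → τ k ≡ tokenOf o → τ l ≡ tokenOf o′ →
          Reveals (tokenOf o) G (f p) → Reveals (tokenOf o′) G (f q) →
          ∀ {t} → EdgeAt G t (f p) (f q) → proj₁ (tokenOf o) ≤ t → proj₁ (tokenOf o′) ≤ t →
          1 ≤ pairHits τ G (f p) (f q)
        known-≥1 k l eq eq′ r r′ e le le′ = pairHits-≥1 τ k l e
          (subst (λ t → Reveals t G _) (sym eq) r) (subst (λ t → Reveals t G _) (sym eq′) r′)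
          (subst (λ t → proj₁ t ≤ _) (sym eq) le) (subst (λ t → proj₁ t ≤ _) (sym eq′) le′)

        leftRevealed : ∀ i → Reveals (tokenOf (inj₁ i)) G (f (left i))
        leftRevealed i = both-reveals (at (left≢right i i))

        rightRevealed : ∀ i → Reveals (tokenOf (inj₁ i)) G (f (right i))
        rightRevealed i = both-reveals (edgeAt-sym (at (left≢right i i)))

        -- `δ` fills the diagonal, where there is no edge, so that one bound covers all entries at a
        -- total price of `n`.
        δ H F : Fin n → Fin n → ℕ
        δ p q = ⟦ p Fin.≟ q ⟧
        H p q = pairHits τ G (f p) (f q)
        F p q = δ p q + H p q

        diagonal : ∀ p → 1 ≤ F p p
        diagonal p = ≤-trans (⟦⟧-yes (p Fin.≟ p) refl) (m≤m+n _ _)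

        pair-pair : ∀ {i j p q t} → Reveals (tokenOf (inj₁ i)) G (f p) →
          Reveals (tokenOf (inj₁ j)) G (f q) → EdgeAt G t (f p) (f q) →
          time (left i) (right i) ⊔ time (left j) (right j) ≤ t → 1 ≤ F p q
        pair-pair {i} {j} r r′ e le = ≤-trans
          (known-≥1 {inj₁ i} {inj₁ j} (i ↑ˡ d) (j ↑ˡ d) (pairToken i) (pairToken j) r r′ e
            (≤-trans (m≤m⊔n _ _) le) (≤-trans (m≤n⊔m _ _) le))
          (m≤n+m _ _)

        pair-single : ∀ {i p t} s → Reveals (tokenOf (inj₁ i)) G (f p) →
          EdgeAt G t (f p) (f (single s)) → time (left i) (right i) ≤ t →
          1 ≤ F p (single s)
        pair-single {i} s r e le = ≤-trans
          (known-≥1 {inj₁ i} {inj₂ s} (i ↑ˡ d) (c ↑ʳ s) (pairToken i) (singleToken s)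
            r (reveals (touch s)) e le (first (touch s) (edgeAt-sym e)))
          (m≤n+m _ _)

        single-pair : ∀ {i p t} s → Reveals (tokenOf (inj₁ i)) G (f p) →
          EdgeAt G t (f p) (f (single s)) → time (left i) (right i) ≤ t →
          1 ≤ F (single s) p
        single-pair {i} s r e le = ≤-trans
          (known-≥1 {inj₂ s} {inj₁ i} (c ↑ʳ s) (i ↑ˡ d) (singleToken s) (pairToken i)
            (reveals (touch s)) r (edgeAt-sym e) (first (touch s) (edgeAt-sym e)) le)
          (m≤n+m _ _)

        single-single : ∀ s t → 1 ≤ F (single s) (single t)
        single-single s t with single s Fin.≟ single t
        ... | yes _  = s≤s z≤n
        ... | no s≢t = known-≥1 {inj₂ s} {inj₂ t} (c ↑ʳ s) (c ↑ʳ t) (singleToken s) (singleToken t)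
            (reveals (touch s)) (reveals (touch t)) e
            (first (touch s) e) (first (touch t) (edgeAt-sym e))
          where e = at s≢t

        pairs : ∀ i j → 2 ≤ (F (left i) (left j) + F (right i) (right j)) +
                            (F (left i) (right j) + F (right i) (left j))
        pairs i j with i Fin.≟ j
        -- Against itself a pair contributes two diagonal entries; against another pair, a parallel
        -- and a cross hit.
        ... | yes refl = ≤-trans (+-mono-≤ (diagonal (left i)) (diagonal (right i))) (m≤m+n _ _)
        ... | no i≢j   = +-mono-≤ (parallel (stable-parallel {G} {f} st i≢j)) (cross (stable-cross {G} {f} st i≢j))
          where
          parallel : _ ⊎ _ → 1 ≤ F (left i) (left j) + F (right i) (right j)
          parallel (inj₁ le) = ≤-trans (pair-pair (leftRevealed i) (leftRevealed j)
            (at (i≢j ∘ left-injective)) le) (m≤m+n _ (F (right i) (right j)))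
          parallel (inj₂ le) = ≤-trans (pair-pair (rightRevealed i) (rightRevealed j)
            (at (i≢j ∘ right-injective)) le) (m≤n+m _ (F (left i) (left j)))
          cross : _ ⊎ _ → 1 ≤ F (left i) (right j) + F (right i) (left j)
          cross (inj₁ le) = ≤-trans (pair-pair (leftRevealed i) (rightRevealed j)
            (at (left≢right i j)) le) (m≤m+n _ (F (right i) (left j)))
          cross (inj₂ le) = ≤-trans (pair-pair (rightRevealed i) (leftRevealed j)
            (edgeAt-sym (at (left≢right j i))) le) (m≤n+m _ (F (left i) (right j)))

      hits-≥ : 2 * (c * c) + 4 * (c * d) + d * d ≤ n + 2 * hits τ G
      hits-≥ = begin
        2 * (c * c) + 4 * (c * d) + d * d
          ≤⟨ ∑∑-arrange-≥ F pairs
               (λ i s → pair-single s (leftRevealed i) (at (left≢single i s)) (stable-left-single {G} {f} st i s))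
               (λ i s → pair-single s (rightRevealed i) (edgeAt-sym (at (right≢single i s ∘ sym))) (stable-single-right {G} {f} st i s))
               (λ s i → single-pair s (leftRevealed i) (at (left≢single i s)) (stable-left-single {G} {f} st i s))
               (λ s i → single-pair s (rightRevealed i) (edgeAt-sym (at (right≢single i s ∘ sym))) (stable-single-right {G} {f} st i s))
               single-single ⟩
        sum (λ p → sum (F p))
          ≡⟨ ∑∑-distrib-+ δ H ⟩
        sum (λ p → sum (δ p)) + sum (λ p → sum (H p))
          ≤⟨ +-mono-≤ (sum-≤ {n} {1} λ p → sum-unique (p Fin.≟_) λ _ _ eq eq′ → trans (sym eq) eq′)
                      (sum-pairHits τ G (injective K)) ⟩
        n * 1 + 2 * hits τ G
          ≡⟨ cong (_+ 2 * hits τ G) (*-identityʳ n) ⟩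
        n + 2 * hits τ G ∎
        where open ≤-Reasoning

-- The lower bound on N

decodeToken : ∀ N → Fin (N * 3) → Token
decodeToken N k = toℕ (proj₁ (remQuot {N} 3 k)) , proj₂ (remQuot {N} 3 k)

decode : ∀ N r → Fin ((N * 3) ^ r) → Fin r → Token
decode N r x i = decodeToken N (finToFun x i)

decode-surjective : ∀ {N r} (τ : Fin r → Token) → (∀ i → proj₁ (τ i) < N) →
                    ∃ λ x → ∀ i → decode N r x i ≡ τ i
decode-surjective {N} {r} τ τ< = funToFin code , λ i → begin
  decodeToken N (finToFun (funToFin code) i)  ≡⟨ cong (decodeToken N) (Fin.finToFun-funToFin code i) ⟩
  decodeToken N (code i)                      ≡⟨ cong (λ (t , m) → toℕ t , m) (Fin.remQuot-combine (fromℕ< (τ< i)) (proj₂ (τ i))) ⟩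
  toℕ (fromℕ< (τ< i)) , proj₂ (τ i)           ≡⟨ cong (_, proj₂ (τ i)) (Fin.toℕ-fromℕ< (τ< i)) ⟩
  τ i                                         ∎
  where
  open ≡-Reasoning
  code : Fin r → Fin (N * 3)
  code i = combine (fromℕ< (τ< i)) (proj₂ (τ i))

module _ (N r : ℕ) where

  -- The union bound as a sum: one gambler for each description and each colour.
  totalWeight : Position → ℕ
  totalWeight G = sum (λ x → weight (decode N r x) red G + weight (decode N r x) blue G)

  totalWeight-[] : totalWeight [] ≡ (N * 3) ^ r * 2
  totalWeight-[] = sum-const ((N * 3) ^ r) 2

  totalWeight-fair : ∀ u v G →
    totalWeight ((u , v , red) ∷ G) + totalWeight ((u , v , blue) ∷ G) ≡ 2 * totalWeight G
  totalWeight-fair u v G = begin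
    sum (both-weights ((u , v , red) ∷ G)) + sum (both-weights ((u , v , blue) ∷ G))
      ≡⟨ ∑-distrib-+ (both-weights ((u , v , red) ∷ G)) (both-weights ((u , v , blue) ∷ G)) ⟨
    sum (λ x → both-weights ((u , v , red) ∷ G) x + both-weights ((u , v , blue) ∷ G) x)
      ≡⟨ sum-cong-≗ fair ⟩
    sum (λ x → 2 * both-weights G x)
      ≡⟨ *-distribˡ-sum 2 (both-weights G) ⟨
    2 * sum (both-weights G) ∎
    where
    open ≡-Reasoning
    both-weights : Position → Fin ((N * 3) ^ r) → ℕ
    both-weights H x = weight (decode N r x) red H + weight (decode N r x) blue H
    regroup : ∀ a b a′ b′ → (a + b) + (a′ + b′) ≡ (a + a′) + (b + b′)
    regroup = solve-∀
    fair : ∀ x → both-weights ((u , v , red) ∷ G) x + both-weights ((u , v , blue) ∷ G) x ≡ 2 * both-weights G x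
    fair x = trans
      (regroup (weight τ red ((u , v , red) ∷ G)) (weight τ blue ((u , v , red) ∷ G))
               (weight τ red ((u , v , blue) ∷ G)) (weight τ blue ((u , v , blue) ∷ G)))
      (trans (cong₂ _+_ (weight-fair τ red u v G) (weight-fair τ blue u v G))
             (sym (*-distribˡ-+ 2 (weight τ red G) (weight τ blue G))))
      where
      τ : Fin r → Token
      τ = decode N r x

  weight≤totalWeight : ∀ κ x G → weight (decode N r x) κ G ≤ totalWeight G
  weight≤totalWeight κ x G = ≤-trans (one κ) (term≤sum _ x)
    where
    one : ∀ κ → weight (decode N r x) κ G ≤ weight (decode N r x) red G + weight (decode N r x) blue G
    one red  = m≤m+n _ _
    one blue = m≤n+m _ _

module _ {c d : ℕ} (i₀ : Fin c) where

  open Arrangement c d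

  -- The gambler who holds the true description and colour of the clique wins at every hit, and
  -- there are at least `h` hits.
  clique⇒weight : ∀ {h N κ G} → 2 * h + n ≤ 2 * (c * c) + 4 * (c * d) + d * d →
    Legal G → length G ≤ N → Clique κ n G → 2 ^ h ≤ totalWeight N (c + d) G
  clique⇒weight {h} {N} {κ} {G} h≤ L len K₀
    with K , st ← stabilise K₀ (<-wellFounded _)
    with x , τ≗ ← decode-surjective {N} (Encoding.tokens L K st i₀)
                    (λ i → ≤-trans (Encoding.tokens-< L K st i₀ i) len) = begin
    2 ^ h                            ≤⟨ ^-monoʳ-≤ 2 h≤hits ⟩
    2 ^ hits (decode N (c + d) x) G  ≡⟨ weight-hits _ κ G (Encoding.monochromatic L K st i₀ τ≗) ⟨
    weight (decode N (c + d) x) κ G  ≤⟨ weight≤totalWeight N (c + d) κ x G ⟩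
    totalWeight N (c + d) G          ∎
    where
    open ≤-Reasoning
    h≤hits : h ≤ hits (decode N (c + d) x) G
    h≤hits = *-cancelˡ-≤ 2 (+-cancelʳ-≤ n _ _ (≤-trans h≤
      (≤-trans (Encoding.hits-≥ L K st i₀ τ≗) (≤-reflexive (+-comm n _)))))

  -- Fair bets preserve the mean total capital, so it cannot start below the 2^h that every final
  -- position guarantees.
  forces-lowerBound : ∀ {h N} → 2 * h + n ≤ 2 * (c * c) + 4 * (c * d) + d * d →
    Forces n n N [] → 2 ^ h ≤ (N * 3) ^ (c + d) * 2
  forces-lowerBound {h} {N} h≤ F = subst (2 ^ h ≤_) (totalWeight-[] N (c + d))
    (forces⇒≤ (totalWeight N (c + d)) (totalWeight-fair N (c + d))
      (λ { L len (inj₁ K) → clique⇒weight {h} h≤ L len K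
         ; L len (inj₂ K) → clique⇒weight {h} h≤ L len K })
      [] (≤-reflexive (+-identityʳ N)) F)

-- Choice of c and passage to 2^x

-- m approximates n / √2 from above.
record Balanced (n : ℕ) : Set where
  field
    m      : ℕ
    lower  : n * n ≤ 2 * (m * m)
    upper  : 2 * (m * m) ≤ n * n + 4 * m
    m<n    : m < n
    n≤2m   : n ≤ 2 * m
    2≤m    : 2 ≤ m

-- When `n` grows by one, `m` stays if it still bounds the new n / √2 from above, and grows by one
-- otherwise.
balanced : ∀ j → Balanced (4 + j)
balanced zero = record
  { m = 3 ; lower = m≤m+n 16 2 ; upper = m≤m+n 18 10 ; m<n = m≤m+n 4 0
  ; n≤2m = m≤m+n 4 2 ; 2≤m = m≤m+n 2 1 }
balanced (suc j) = step (4 + j) (balanced j)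
  where
  step : ∀ n → Balanced n → Balanced (suc n)
  step n b with suc n * suc n ≤? 2 * (Balanced.m b * Balanced.m b)
  ... | yes le = record
    { m = m ; lower = le
    ; upper = ≤-trans upper (+-monoˡ-≤ (4 * m) (*-mono-≤ (n≤1+n n) (n≤1+n n)))
    ; m<n = m≤n⇒m≤1+n m<n ; n≤2m = ≮⇒≥ contra ; 2≤m = 2≤m }
    where
    open Balanced b
    open ≤-Reasoning
    double-square : ∀ m → 2 * m * (2 * m) ≡ 2 * (m * m) + 2 * (m * m)
    double-square = solve-∀
    contra : ¬ 2 * m < suc n
    contra (s≤s 2m≤n) = <⇒≱ (s≤s (begin
      2 * (m * m)                ≤⟨ m≤m+n _ _ ⟩
      2 * (m * m) + 2 * (m * m)  ≡⟨ double-square m ⟨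
      2 * m * (2 * m)            ≤⟨ *-mono-≤ 2m≤n 2m≤n ⟩
      n * n                      ≤⟨ *-monoʳ-≤ n (n≤1+n n) ⟩
      n * suc n                  ≤⟨ m≤n+m (n * suc n) n ⟩
      n + n * suc n              ∎)) le
  ... | no nle = record
    { m = suc m
    ; lower = begin
        suc n * suc n                ≡⟨ square-suc n ⟩
        n * n + 2 * n + 1            ≤⟨ +-monoˡ-≤ 1 (+-mono-≤ lower (*-monoʳ-≤ 2 n≤2m)) ⟩
        2 * (m * m) + 2 * (2 * m) + 1 ≤⟨ n≤1+n _ ⟩
        suc (2 * (m * m) + 2 * (2 * m) + 1) ≡⟨ double-square-suc m ⟨
        2 * (suc m * suc m)          ∎
    ; upper = begin
        2 * (suc m * suc m)            ≡⟨ double-square-suc m ⟩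
        suc (2 * (m * m) + 2 * (2 * m) + 1) ≡⟨ regroup (2 * (m * m)) m ⟩
        suc (2 * (m * m)) + (4 * m + 1)  ≤⟨ +-mono-≤ (≰⇒> nle) (+-monoʳ-≤ (4 * m) (s≤s z≤n)) ⟩
        suc n * suc n + (4 * m + 4)    ≡⟨ cong (suc n * suc n +_) (trans (+-comm (4 * m) 4) (sym (*-suc 4 m))) ⟩
        suc n * suc n + 4 * suc m      ∎
    ; m<n = s≤s m<n
    ; n≤2m = begin
        suc n      ≤⟨ s≤s n≤2m ⟩
        suc (2 * m) ≤⟨ n≤1+n _ ⟩
        2 + 2 * m  ≡⟨ *-suc 2 m ⟨
        2 * suc m  ∎
    ; 2≤m = m≤n⇒m≤1+n 2≤m }
    where
    open Balanced b
    open ≤-Reasoning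
    square-suc : ∀ n → suc n * suc n ≡ n * n + 2 * n + 1
    square-suc = solve-∀
    double-square-suc : ∀ m → 2 * (suc m * suc m) ≡ suc (2 * (m * m) + 2 * (2 * m) + 1)
    double-square-suc = solve-∀
    regroup : ∀ x m → suc (x + 2 * (2 * m) + 1) ≡ suc x + (4 * m + 1)
    regroup = solve-∀

-- With s = B / E > √2 this says 2m ≤ s n + 4.
sqrt-bound : ∀ {n m B E} → 2 * (E * E) < B * B → 2 ≤ m → 2 * (m * m) ≤ n * n + 4 * m →
             2 * m * E ≤ B * n + 4 * E
sqrt-bound {n} {suc (suc l)} {B} {E} E<B (s≤s (s≤s _)) upper =
  -- With m = l + 2, the bound `upper` gives 2l² ≤ n², hence 2l ≤ sn; the shift by 2 costs the 4.
  subst (_≤ B * n + 4 * E) (sym (shift l E)) (+-monoˡ-≤ (4 * E) 2lE≤Bn)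
  where
  open ≤-Reasoning
  shift : ∀ l E → 2 * (2 + l) * E ≡ 2 * l * E + 4 * E
  shift = solve-∀
  square-product : ∀ l E → 2 * l * E * (2 * l * E) ≡ 2 * (E * E) * (2 * (l * l))
  square-product = solve-∀
  square-product′ : ∀ B n → B * B * (n * n) ≡ B * n * (B * n)
  square-product′ = solve-∀
  expand : ∀ l → 2 * ((2 + l) * (2 + l)) ≡ 2 * (l * l) + 4 * l + 4 * (2 + l)
  expand = solve-∀
  2l²≤n² : 2 * (l * l) ≤ n * n
  2l²≤n² = ≤-trans (m≤m+n _ (4 * l))
    (+-cancelʳ-≤ (4 * (2 + l)) _ _ (≤-trans (≤-reflexive (sym (expand l))) upper))
  2lE≤Bn : 2 * l * E ≤ B * n
  2lE≤Bn = ≮⇒≥ λ lt → <⇒≱ (*-mono-< lt lt) (begin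
    2 * l * E * (2 * l * E)      ≡⟨ square-product l E ⟩
    2 * (E * E) * (2 * (l * l))  ≤⟨ *-mono-≤ (<⇒≤ E<B) 2l²≤n² ⟩
    B * B * (n * n)              ≡⟨ square-product′ B n ⟩
    B * n * (B * n)              ∎)

-- With q = P / D and s = B / E, the hypothesis is q + 9 + sn ≤ 2n and the conclusion is (2q + 9)m ≤
-- 4nm - n² - 2m², denominators cleared.
exponent-bound : ∀ {n m B E} P D .{{_ : NonZero E}} → 2 * (E * E) < B * B →
  n * n ≤ 2 * (m * m) → 2 * (m * m) ≤ n * n + 4 * m → 2 ≤ m →
  P * E + 9 * D * E + B * n * D ≤ 2 * D * n * E →
  2 * P * m + 9 * D * m + D * (n * n + 2 * (m * m)) ≤ D * (4 * n * m)
exponent-bound {n} {m} {B} {E} P D E<B lower upper 2≤m hyp = *-cancelʳ-≤ _ _ E (begin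
  (2 * P * m + 9 * D * m + D * (n * n + 2 * (m * m))) * E
    ≤⟨ *-monoˡ-≤ E (+-monoʳ-≤ (2 * P * m + 9 * D * m) (*-monoʳ-≤ D (+-monoˡ-≤ (2 * (m * m)) lower))) ⟩
  (2 * P * m + 9 * D * m + D * (2 * (m * m) + 2 * (m * m))) * E
    ≡⟨ e₁ P D E m ⟩
  2 * P * m * E + 9 * D * m * E + 2 * D * m * (2 * m * E)
    ≤⟨ +-monoʳ-≤ (2 * P * m * E + 9 * D * m * E) (*-monoʳ-≤ (2 * D * m) (sqrt-bound {n} {m} {B} {E} E<B 2≤m upper)) ⟩
  2 * P * m * E + 9 * D * m * E + 2 * D * m * (B * n + 4 * E)
    -- The 9 of the goal and 8 from rounding `m` make 17, within the 18 that twice the hypothesis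
    -- provides.
    ≤⟨ m≤m+n _ (D * m * E) ⟩
  2 * P * m * E + 9 * D * m * E + 2 * D * m * (B * n + 4 * E) + D * m * E
    ≡⟨ e₂ P D E m B n ⟩
  2 * m * (P * E + 9 * D * E + B * n * D)
    ≤⟨ *-monoʳ-≤ (2 * m) hyp ⟩
  2 * m * (2 * D * n * E)
    ≡⟨ e₃ D E m n ⟩
  D * (4 * n * m) * E ∎)
  where
  open ≤-Reasoning
  e₁ : ∀ P D E m → (2 * P * m + 9 * D * m + D * (2 * (m * m) + 2 * (m * m))) * E ≡
       2 * P * m * E + 9 * D * m * E + 2 * D * m * (2 * m * E)
  e₁ = solve-∀
  e₂ : ∀ P D E m B n → 2 * P * m * E + 9 * D * m * E + 2 * D * m * (B * n + 4 * E) + D * m * E ≡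
       2 * m * (P * E + 9 * D * E + B * n * D)
  e₂ = solve-∀
  e₃ : ∀ D E m n → 2 * m * (2 * D * n * E) ≡ D * (4 * n * m) * E
  e₃ = solve-∀

^-distribʳ-* : ∀ k x y → (x * y) ^ k ≡ x ^ k * y ^ k
^-distribʳ-* zero    x y = refl
^-distribʳ-* (suc k) x y = trans (cong (x * y *_) (^-distribʳ-* k x y)) (interchange x y (x ^ k) (y ^ k))
  where
  interchange : ∀ a b c d → a * b * (c * d) ≡ a * c * (b * d)
  interchange = solve-∀

^-cancelˡ-≤ : ∀ k .{{_ : NonZero k}} {x y} → x ^ k ≤ y ^ k → x ≤ y
^-cancelˡ-≤ k le = ≮⇒≥ λ y<x → <⇒≱ (^-monoˡ-< k y<x) le

-- `h` is half the gap rounded down, so doubling it loses at most one.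
halve : ∀ {a b} → a ≤ b → ∃ λ h → 2 * h + a ≤ b × b ≤ 2 * h + a + 1
halve {a} {b} a≤b = h , lo , hi
  where
  open ≤-Reasoning
  h r : ℕ
  h = ⌊ b ∸ a /2⌋
  r = ⌈ b ∸ a /2⌉
  b≡ : h + r + a ≡ b
  b≡ = trans (cong (_+ a) (⌊n/2⌋+⌈n/2⌉≡n (b ∸ a))) (m∸n+n≡m a≤b)
  lo : 2 * h + a ≤ b
  lo = begin
    2 * h + a  ≡⟨ cong (λ x → h + x + a) (+-identityʳ h) ⟩
    h + h + a  ≤⟨ +-monoˡ-≤ a (+-monoʳ-≤ h (⌊n/2⌋≤⌈n/2⌉ (b ∸ a))) ⟩
    h + r + a  ≡⟨ b≡ ⟩
    b          ∎
  shift : ∀ h a → h + suc h + a ≡ 2 * h + a + 1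
  shift = solve-∀
  hi : b ≤ 2 * h + a + 1
  hi = begin
    b              ≡⟨ b≡ ⟨
    -- ⌈x/2⌉ = ⌊(x+1)/2⌋ ≤ ⌊(x+2)/2⌋ = 1 + ⌊x/2⌋.
    h + r + a      ≤⟨ +-monoˡ-≤ a (+-monoʳ-≤ h (⌊n/2⌋-mono (n≤1+n (suc (b ∸ a))))) ⟩
    h + suc h + a  ≡⟨ shift h a ⟩
    2 * h + a + 1  ∎

-- The exponential bound on the number of turns

module _ {n N : ℕ} (b : Balanced n) (F : Forces n n N []) where

  open Balanced b

  private
    c d Q : ℕ
    -- The solution of c + d = m and 2c + d = n.
    c = n ∸ m
    d = 2 * m ∸ n
    Q = 2 * (c * c) + 4 * (c * d) + d * d

    m+c≡n : m + c ≡ n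
    m+c≡n = m+[n∸m]≡n (<⇒≤ m<n)

    c+d≡m : c + d ≡ m
    c+d≡m = +-cancelˡ-≡ m _ _ (begin
      m + (c + d)  ≡⟨ +-assoc m c d ⟨
      m + c + d    ≡⟨ cong (_+ d) m+c≡n ⟩
      n + d        ≡⟨ m+[n∸m]≡n n≤2m ⟩
      2 * m        ≡⟨ cong (m +_) (+-identityʳ m) ⟩
      m + m        ∎)
      where open ≡-Reasoning

    order : c + (c + d) ≡ n
    order = trans (cong (c +_) c+d≡m) (trans (+-comm c m) m+c≡n)

    -- Thus Q / m = 4n - n²/m - 2m, which is largest at m = n / √2, with value (4 - 2√2)n.
    Q-identity : n * n + 2 * (m * m) + Q ≡ 4 * n * m
    Q-identity = subst₂ (λ n m → n * n + 2 * (m * m) + Q ≡ 4 * n * m) order c+d≡m (identity c d)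
      where
      identity : ∀ c d → (c + (c + d)) * (c + (c + d)) + 2 * ((c + d) * (c + d)) +
                         (2 * (c * c) + 4 * (c * d) + d * d) ≡ 4 * (c + (c + d)) * (c + d)
      identity = solve-∀

    n≤Q : c + (c + d) ≤ Q
    n≤Q = begin
      c + (c + d)                ≡⟨ +-assoc c c d ⟨
      c + c + d                  ≤⟨ +-mono-≤ (+-mono-≤ (m≤m*m c) (m≤m*m c)) (m≤m*m d) ⟩
      c * c + c * c + d * d      ≡⟨ cong (λ x → c * c + x + d * d) (+-identityʳ (c * c)) ⟨
      2 * (c * c) + d * d        ≤⟨ +-monoˡ-≤ (d * d) (m≤m+n (2 * (c * c)) (4 * (c * d))) ⟩
      Q                          ∎
      where
      open ≤-Reasoning
      m≤m*m : ∀ x → x ≤ x * x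
      m≤m*m zero    = z≤n
      m≤m*m (suc x) = m≤m*n (suc x) (suc x)

    h : ℕ
    h = proj₁ (halve n≤Q)

    i₀ : Fin c
    i₀ = fromℕ< (m<n⇒0<n∸m m<n)

    2^h≤ : 2 ^ h ≤ (N * 3) ^ m * 2
    2^h≤ = subst (λ r → 2 ^ h ≤ (N * 3) ^ r * 2) c+d≡m
      (forces-lowerBound {c} {d} i₀ {h} (proj₁ (proj₂ (halve n≤Q)))
        (subst (λ n → Forces n n N []) (sym order) F))

    instance
      m≢0 : NonZero m
      m≢0 = >-nonZero (≤-trans (s≤s z≤n) 2≤m)

  -- For the negative rationals in the cut. If N were 0, the upper bound on 2^h would vanish, as m >
  -- 0.
  forces-positive : 1 ≤ N
  forces-positive = positive N refl
    where
    0^m : ∀ k .{{_ : NonZero k}} → 0 ^ k ≡ 0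
    0^m (suc k) = refl
    positive : ∀ N′ → N ≡ N′ → 1 ≤ N′
    positive (suc _) _    = s≤s z≤n
    positive zero    refl = contradiction (≤-trans (m^n>0 2 h) 2^h≤) (λ le →
      <⇒≱ le (≤-reflexive (cong (_* 2) (0^m m))))

  -- In doubled exponents the factor 2^(3m) costs 6m and passing from `Q` to 2h another 3m: these
  -- are the 9m in `exponent-bound`.
  forces-exponential : ∀ {B E} P D .{{_ : NonZero E}} → 2 * (E * E) < B * B →
    P * E + 9 * D * E + B * n * D ≤ 2 * D * n * E → 2 ^ P ≤ N ^ D
  forces-exponential {B} {E} P D E<B hyp = ^-cancelˡ-≤ m
    -- Raised to the power `m` and multiplied by 2^(3mD), the claim reduces to comparing exponents
    -- with hD.
    (*-cancelʳ-≤ ((2 ^ P) ^ m) ((N ^ D) ^ m) (2 ^ (3 * m * D)) {{m^n≢0 2 (3 * m * D)}} (begin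
      (2 ^ P) ^ m * 2 ^ (3 * m * D)       ≡⟨ cong (_* 2 ^ (3 * m * D)) (^-*-assoc 2 P m) ⟩
      2 ^ (P * m) * 2 ^ (3 * m * D)       ≡⟨ ^-distribˡ-+-* 2 (P * m) (3 * m * D) ⟨
      2 ^ (P * m + 3 * m * D)             ≤⟨ ^-monoʳ-≤ 2 exponents ⟩
      2 ^ (h * D)                         ≡⟨ ^-*-assoc 2 h D ⟨
      (2 ^ h) ^ D                         ≤⟨ ^-monoˡ-≤ D 2^h≤N^m ⟩
      (N ^ m * 2 ^ (3 * m)) ^ D           ≡⟨ ^-distribʳ-* D (N ^ m) (2 ^ (3 * m)) ⟩
      (N ^ m) ^ D * (2 ^ (3 * m)) ^ D     ≡⟨ cong₂ _*_ swap (^-*-assoc 2 (3 * m) D) ⟩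
      (N ^ D) ^ m * 2 ^ (3 * m * D)       ∎))
    where
    open ≤-Reasoning
    swap : (N ^ m) ^ D ≡ (N ^ D) ^ m
    swap = trans (^-*-assoc N m D) (trans (cong (N ^_) (*-comm m D)) (sym (^-*-assoc N D m)))

    triple : ∀ m → 2 * m + m ≡ 3 * m
    triple = solve-∀

    2^h≤N^m : 2 ^ h ≤ N ^ m * 2 ^ (3 * m)
    2^h≤N^m = begin
      2 ^ h                          ≤⟨ 2^h≤ ⟩
      -- 3 ≤ 2² and 2 ≤ 2^m gather all constants in 2^(3m).
      (N * 3) ^ m * 2                ≤⟨ *-mono-≤ (^-monoˡ-≤ m (*-monoʳ-≤ N (n≤1+n 3))) (^-monoʳ-≤ 2 (≤-trans (s≤s z≤n) 2≤m)) ⟩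
      (N * 4) ^ m * 2 ^ m            ≡⟨ cong (_* 2 ^ m) (^-distribʳ-* m N 4) ⟩
      N ^ m * (2 ^ 2) ^ m * 2 ^ m    ≡⟨ *-assoc (N ^ m) _ _ ⟩
      N ^ m * ((2 ^ 2) ^ m * 2 ^ m)  ≡⟨ cong (λ x → N ^ m * (x * 2 ^ m)) (^-*-assoc 2 2 m) ⟩
      N ^ m * (2 ^ (2 * m) * 2 ^ m)  ≡⟨ cong (N ^ m *_) (^-distribˡ-+-* 2 (2 * m) m) ⟨
      N ^ m * 2 ^ (2 * m + m)        ≡⟨ cong (λ x → N ^ m * 2 ^ x) (triple m) ⟩
      N ^ m * 2 ^ (3 * m)            ∎

    Q≤ : Q ≤ 2 * h + 3 * m
    Q≤ = begin
      Q                    ≤⟨ proj₂ (proj₂ (halve n≤Q)) ⟩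
      2 * h + (c + (c + d)) + 1 ≡⟨ cong (λ x → 2 * h + x + 1) order ⟩
      2 * h + n + 1        ≡⟨ +-assoc (2 * h) n 1 ⟩
      2 * h + (n + 1)      ≤⟨ +-monoʳ-≤ (2 * h) (+-mono-≤ n≤2m (≤-trans (s≤s z≤n) 2≤m)) ⟩
      2 * h + (2 * m + m)  ≡⟨ cong (2 * h +_) (triple m) ⟩
      2 * h + 3 * m        ∎

    e₁ : ∀ P D m → 2 * (P * m + 3 * m * D) + D * (3 * m) ≡ 2 * P * m + 9 * D * m
    e₁ = solve-∀
    e₂ : ∀ D h m → D * (2 * h + 3 * m) ≡ 2 * (h * D) + D * (3 * m)
    e₂ = solve-∀

    S : ℕ
    S = n * n + 2 * (m * m)

    exponents : P * m + 3 * m * D ≤ h * D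
    exponents = *-cancelˡ-≤ 2 (+-cancelʳ-≤ (D * (3 * m)) _ _ (begin
      2 * (P * m + 3 * m * D) + D * (3 * m)  ≡⟨ e₁ P D m ⟩
      2 * P * m + 9 * D * m                  ≤⟨ +-cancelʳ-≤ (D * S) _ _ (begin
        2 * P * m + 9 * D * m + D * S  ≤⟨ exponent-bound {n} {m} {B} {E} P D E<B lower upper 2≤m hyp ⟩
        D * (4 * n * m)                ≡⟨ cong (D *_) Q-identity ⟨
        D * (S + Q)                    ≡⟨ trans (cong (D *_) (+-comm S Q)) (*-distribˡ-+ D Q S) ⟩
        D * Q + D * S                  ∎) ⟩
      D * Q                                  ≤⟨ *-monoʳ-≤ D Q≤ ⟩
      D * (2 * h + 3 * m)                    ≡⟨ e₂ D h m ⟩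
      2 * (h * D) + D * (3 * m)              ∎))

-- From cuts to inequalities between natural numbers

open import Data.Integer.Base using (+_; -[1+_])

≤-⇒+≤ : ∀ {x y z} → x ℚᵘ.≤ y ℚᵘ.- z → x ℚᵘ.+ z ℚᵘ.≤ y
≤-⇒+≤ {x} {y} {z} le = begin
  x ℚᵘ.+ z                ≤⟨ ℚᵘ.+-monoˡ-≤ z le ⟩
  y ℚᵘ.- z ℚᵘ.+ z         ≃⟨ ℚᵘ.+-assoc y (ℚᵘ.- z) z ⟩
  y ℚᵘ.+ (ℚᵘ.- z ℚᵘ.+ z)  ≃⟨ ℚᵘ.+-congʳ y (ℚᵘ.+-inverseˡ z) ⟩
  y ℚᵘ.+ 0ℚᵘ              ≃⟨ ℚᵘ.+-identityʳ y ⟩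
  y                       ∎
  where open ℚᵘ.≤-Reasoning

-- Of the witnesses in the cut only a rational s above √2 is kept; chaining the inequalities
-- eliminates the others.
below-exponent : ∀ {n C q} → below (n · (rat (+ 2 / 1) ⊖ √2) ⊖ rat C) q →
  ∃ λ s → above √2 s × q ℚᵘ.+ C ℚᵘ.+ + n / 1 ℚᵘ.* s ℚᵘ.≤ + n / 1 ℚᵘ.* (+ 2 / 1)
below-exponent {n} {C} {q} (a , b , (a′ , (t , s , t<2 , √2<s , a′≤t-s) , a<na′) , C<b , q≤a-b) =
  s , √2<s , (begin
    q ℚᵘ.+ C ℚᵘ.+ ν ℚᵘ.* s     ≤⟨ ℚᵘ.+-monoˡ-≤ (ν ℚᵘ.* s) (ℚᵘ.+-monoʳ-≤ q (ℚᵘ.<⇒≤ C<b)) ⟩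
    q ℚᵘ.+ b ℚᵘ.+ ν ℚᵘ.* s     ≤⟨ ℚᵘ.+-monoˡ-≤ (ν ℚᵘ.* s) (≤-⇒+≤ {q} {a} {b} q≤a-b) ⟩
    a ℚᵘ.+ ν ℚᵘ.* s            ≤⟨ ℚᵘ.+-monoˡ-≤ (ν ℚᵘ.* s) (ℚᵘ.<⇒≤ a<na′) ⟩
    ν ℚᵘ.* a′ ℚᵘ.+ ν ℚᵘ.* s    ≃⟨ ℚᵘ.*-distribˡ-+ ν a′ s ⟨
    ν ℚᵘ.* (a′ ℚᵘ.+ s)         ≤⟨ ℚᵘ.*-monoʳ-≤-nonNeg ν (≤-⇒+≤ {a′} {t} {s} a′≤t-s) ⟩
    ν ℚᵘ.* t                   ≤⟨ ℚᵘ.*-monoʳ-≤-nonNeg ν (ℚᵘ.<⇒≤ t<2) ⟩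
    ν ℚᵘ.* (+ 2 / 1)           ∎)
  where
  open ℚᵘ.≤-Reasoning
  ν : ℚᵘ
  ν = + n / 1

√2-above-ℕ : ∀ {B e} → above √2 (mkℚᵘ (+ B) e) → 2 * (suc e * suc e) < B * B
√2-above-ℕ {B} {e} (_ , ℚᵘ.*<* lt)
  rewrite sym (ℤ.pos-* B B) | sym (ℤ.pos-* 2 (suc e * suc e)) | sym (ℤ.pos-* (B * B) 1)
        | *-identityʳ (B * B)
  = ℤ.drop‿+<+ lt

-- Cross-multiplication: the rewrites move every integer product under `+_`, so that the comparison
-- descends to ℕ.
exponent-ℕ : ∀ {n P B d e} →
  mkℚᵘ (+ P) d ℚᵘ.+ + 9 / 1 ℚᵘ.+ + n / 1 ℚᵘ.* mkℚᵘ (+ B) e ℚᵘ.≤ + n / 1 ℚᵘ.* (+ 2 / 1) →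
  P * suc e + 9 * suc d * suc e + B * n * suc d ≤ 2 * suc d * n * suc e
exponent-ℕ {n} {P} {B} {d} {e} (ℚᵘ.*≤* le)
  rewrite sym (ℤ.pos-* P 1) | sym (ℤ.pos-* 9 (suc d)) | sym (ℤ.pos-* n B)
        | sym (ℤ.pos-* (P * 1 + 9 * suc d) (1 * suc e))
        | sym (ℤ.pos-* (n * B) (suc d * 1))
        | sym (ℤ.pos-* n 2)
        | sym (ℤ.pos-* ((P * 1 + 9 * suc d) * (1 * suc e) + n * B * (suc d * 1)) 1)
        | sym (ℤ.pos-* (n * 2) (suc d * 1 * (1 * suc e)))
  = subst₂ _≤_ (lhs P (suc d) (suc e) n B) (rhs (suc d) (suc e) n) (ℤ.drop‿+≤+ le)
  where
  lhs : ∀ P D E n B → ((P * 1 + 9 * D) * (1 * E) + n * B * (D * 1)) * 1 ≡ P * E + 9 * D * E + B * n * D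
  lhs = solve-∀
  rhs : ∀ D E n → n * 2 * (D * 1 * (1 * E)) ≡ 2 * D * n * E
  rhs = solve-∀

corollary2 : Σ[ C ∈ ℚᵘ ] Σ[ n₀ ∈ ℕ ] ((n : ℕ) → n₀ ≤ n → diagonalOnlineRamsey n ≥2^ n · (rat (+ 2 / 1) ⊖ √2) ⊖ rat C)
-- 9 is half of the loss 17 in `exponent-bound`, rounded up; 4 is where `balanced` begins.
corollary2 = + 9 / 1 , 4 , bound
  where
  bound : (n : ℕ) → 4 ≤ n → diagonalOnlineRamsey n ≥2^ n · (rat (+ 2 / 1) ⊖ √2) ⊖ rat (+ 9 / 1)
  bound n 4≤n q q∈ = go q (below-exponent {n} {+ 9 / 1} {q} q∈)
    where
    b : Balanced n
    b = subst Balanced (m+[n∸m]≡n 4≤n) (balanced (n ∸ 4))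

    F : Forces n n (diagonalOnlineRamsey n) []
    F = proj₁ (onlineRamsey-spec n n)

    go : ∀ q → (∃ λ s → above √2 s × q ℚᵘ.+ + 9 / 1 ℚᵘ.+ + n / 1 ℚᵘ.* s ℚᵘ.≤ + n / 1 ℚᵘ.* (+ 2 / 1)) →
         diagonalOnlineRamsey n ≥2^ℚ q
    -- A negative exponent follows from N ≥ 1 alone.
    go (mkℚᵘ -[1+ p ] d) _ = *-mono-≤ (m^n>0 2 (suc p))
      (subst (_≤ diagonalOnlineRamsey n ^ suc d) (^-zeroˡ (suc d)) (^-monoˡ-≤ (suc d) (forces-positive b F)))
    go (mkℚᵘ (+ P) d) (mkℚᵘ -[1+ _ ] e , (ℚᵘ.*<* () , _) , _)
    go (mkℚᵘ (+ P) d) (mkℚᵘ (+ B) e , √2<s , le) =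
      forces-exponential b F {B} {suc e} P (suc d) (√2-above-ℕ {B} {e} √2<s) (exponent-ℕ {n} {P} {B} {d} {e} le)
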